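{- Let $M$ be a matroid with ground set $E$ and rank function $r$, and let $k>0$ be an integer. The following are equivalent: (i) $M$ has tree-width at least $k$; (ii) $M$ has no $S_k$-tree over $\mathcal F_k$; (iii) $M$ has an $\mathcal F_k$-tangle of $S_k$.
   Context: $\lambda(X)=r(X)+r(E\setminus X)-r(M)$. $\vec U$ is the set of ordered bipartitions $(X,Y)$ of $E$ (parts may be empty), ordered by $(A,B)\le(C,D)$ iff $A\subseteq C$, $B\supseteq D$, inverse $(B,A)$; $\{A,B\}$ is the unoriented separation; $\mathrm{ord}(X,Y)=\lambda(X)$; $\vec S_k=\{(A,B)\in\vec U:\mathrm{ord}(A,B)<k\}$, $S_k$ the unoriented ones. An orientation of $S_k$ is a set $O\subseteq\vec S_k$ containing exactly one of $(A,B),(B,A)$ for each $\{A,B\}\in S_k$; it is consistent if there are no $(A,B),(C,D)\in\vec S_k$ with $\{A,B\}\ne\{C,D\}$, $(A,B)<(C,D)$, $(B,A)\in O$, $(C,D)\in O$. A star is a set $\sigma$ with $(A,B)\ne(B,A)$ for each element and $(A,B)\le(D,C)$ for distinct $(A,B),(C,D)\in\sigma$. For a star $\sigma=\{(A_i,B_i):i=0,\dots,n\}$, $\langle\sigma\rangle=r(M)+\sum_{i=0}^n(r(B_i)-r(M))$; $\mathcal F_k$ is the set of stars $\sigma\subseteq\vec U$ with $\langle\sigma\rangle<k$. An $\mathcal F_k$-tangle of $S_k$ is a consistent orientation of $S_k$ with no subset in $\mathcal F_k$. An $S_k$-tree over $\mathcal F_k$ is a pair $(T,\alpha)$, $T$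 a finite tree with at least one node, $\alpha$ assigning to each ordered pair $(x,y)$ with $xy\in E(T)$ an element $\alpha(x,y)\in\vec S_k$ with $\alpha(y,x)$ the inverse of $\alpha(x,y)$ and $\{\alpha(x,t):xt\in E(T)\}\in\mathcal F_k$ for every node $t$. A tree-decomposition of $M$ is a pair $(T,\tau)$ with $T$ a tree and $\tau\colon E\to V(T)$; for a node $t$ with components $T_1,\dots,T_d$ of $T-t$ and $F_i=\tau^{ -1}(V(T_i))$, the width of $t$ is $\sum_{i=1}^dr(E\setminus F_i)-(d-1)r(M)$ (and $r(M)$ if $T$ has one node); the width of $(T,\tau)$ is the maximum node width and the tree-width of $M$ is the minimum width of a tree-decomposition. -}

module Defs where

open import Data.Nat as ℕ using (ℕ; zero; suc)
open import Data.Integer as ℤ using (ℤ; +_; _-_; _⊔_)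
open import Data.Bool using (Bool; true; false)
open import Data.Fin as Fin using (Fin; toℕ)
open import Data.Fin.Subset using (Subset; _⊆_; ∁; _∪_; _∩_; ∣_∣; ⊤)
open import Data.List using (List; []; _∷_; map; filter; foldr; length; _++_; allFin)
open import Data.List.Membership.Propositional using (_∈_)
open import Data.List.Relation.Unary.All using (All)
open import Data.List.Relation.Unary.Unique.Propositional using (Unique)
open import Data.Maybe using (Maybe; just; nothing)
open import Data.Product using (Σ; _×_; _,_; proj₁; proj₂; ∃)
open import Data.Sum using (_⊎_)
open import Data.Empty using (⊥)
open import Relation.Nullary using (¬_)
open import Relation.Binary.PropositionalEquality using (_≡_; _≢_)
open import Function.Bundles using (_⇔_)

record Matroid (n : ℕ) : Set where
  field
    r        : Subset n → ℕ
    r-bound  : ∀ X → r X ℕ.≤ ∣ X ∣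
    r-mono   : ∀ {X Y} → X ⊆ Y → r X ℕ.≤ r Y
    r-submod : ∀ X Y → r (X ∪ Y) ℕ.+ r (X ∩ Y) ℕ.≤ r X ℕ.+ r Y

sumℤ : List ℤ → ℤ
sumℤ = foldr ℤ._+_ (+ 0)

Sep : ℕ → Set
Sep n = Subset n × Subset n

IsBip : ∀ {n} → Sep n → Set
IsBip (X , Y) = Y ≡ ∁ X

inv : ∀ {n} → Sep n → Sep n
inv (A , B) = (B , A)

_≤S_ : ∀ {n} → Sep n → Sep n → Set
(A , B) ≤S (C , D) = A ⊆ C × D ⊆ B

_<S_ : ∀ {n} → Sep n → Sep n → Set
s <S t = s ≤S t × s ≢ t

module _ {n : ℕ} (M : Matroid n) where
  open Matroid M

  rM : ℕ
  rM = r ⊤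

  conn : Subset n → ℤ
  conn X = (+ r X ℤ.+ + r (∁ X)) - + rM

  ord : Sep n → ℤ
  ord (X , Y) = conn X

  InS : ℕ → Sep n → Set
  InS k s = IsBip s × ord s ℤ.< + k

  IsStar : List (Sep n) → Set
  IsStar σ = (∀ s → s ∈ σ → s ≢ inv s)
           × (∀ s t → s ∈ σ → t ∈ σ → s ≢ t → s ≤S inv t)

  ⟨_⟩ : List (Sep n) → ℤ
  ⟨ σ ⟩ = + rM ℤ.+ sumℤ (map (λ s → + r (proj₂ s) - + rM) σ)

  -- σ ∈ F_k, for a finite set σ represented by a duplicate-free list
  InF : ℕ → List (Sep n) → Set
  InF k σ = All IsBip σ × IsStar σ × ⟨ σ ⟩ ℤ.< + k

  SetInF : ℕ → List (Sep n) → Set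
  SetInF k l = Σ (List (Sep n)) λ σ → Unique σ × (∀ s → (s ∈ σ) ⇔ (s ∈ l)) × InF k σ

  -- F_k-tangles of S_k; an orientation is a subset O ⊆ U⃗ given by its
  -- characteristic function.

  IsTangle : ℕ → (Sep n → Bool) → Set
  IsTangle k O =
      (∀ s → O s ≡ true → InS k s)
    × (∀ s → InS k s → O s ≡ true ⊎ O (inv s) ≡ true)
    × (∀ s → InS k s → s ≢ inv s → O s ≡ true → O (inv s) ≡ true → ⊥)
    × (∀ s t → InS k s → InS k t → s ≢ t → s ≢ inv t → s <S t
         → O (inv s) ≡ true → O t ≡ true → ⊥)
    × (∀ σ → Unique σ → All (λ s → O s ≡ true) σ → ¬ InF k σ)

  HasTangle : ℕ → Set
  HasTangle k = Σ (Sep n → Bool) (IsTangle k)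

-- Finite trees. A tree with suc m nodes is encoded on the node set
-- Fin (suc m), rooted at zero, with node (suc i) having parent
-- par i, where toℕ (par i) ≤ toℕ i.  Its edges are indexed by Fin m:
-- edge i joins node (suc i) (the child) and par i.  Every finite tree
-- with at least one node is isomorphic to such a tree.

record Tree : Set where
  field
    m      : ℕ
    par    : Fin m → Fin (suc m)
    par-lt : ∀ i → toℕ (par i) ℕ.≤ toℕ i

  Node : Set
  Node = Fin (suc m)

  child : Fin m → Node
  child i = Fin.suc i

  downEdges : Node → List (Fin m)
  downEdges t = filter (λ i → par i Fin.≟ t) (allFin m)

  upEdge : Node → Maybe (Fin m)
  upEdge Fin.zero    = nothing
  upEdge (Fin.suc i) = just i

  ancF : ℕ → Node → Node → Bool
  ancF _       a x with a Fin.≟ x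
  ... | Relation.Nullary.yes _ = true
  ancF zero    a x | Relation.Nullary.no _ = false
  ancF (suc f) a Fin.zero    | Relation.Nullary.no _ = false
  ancF (suc f) a (Fin.suc i) | Relation.Nullary.no _ = ancF f a (par i)

  inSubtree : Node → Node → Bool
  inSubtree a x = ancF (suc m) a x

  degree : Node → ℕ
  degree t = length (downEdges t) ℕ.+ (maybe′ t)
    where
      maybe′ : Node → ℕ
      maybe′ Fin.zero    = 0
      maybe′ (Fin.suc _) = 1

module _ {n : ℕ} (M : Matroid n) where

  -- α i = α(child i , par i); α(par i , child i) = inv (α i)
  IsSkTree : ℕ → (T : Tree) → (Fin (Tree.m T) → Sep n) → Set
  IsSkTree k T α =
      (∀ i → InS M k (α i) × InS M k (inv (α i)))
    × (∀ t → SetInF M k (map α (downEdges t) ++ upSeps t))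
    where
      open Tree T
      upSeps : Node → List (Sep n)
      upSeps t with upEdge t
      ... | nothing = []
      ... | just i  = inv (α i) ∷ []

  HasSkTree : ℕ → Set
  HasSkTree k = Σ Tree λ T → Σ (Fin (Tree.m T) → Sep n) λ α → IsSkTree k T α

module _ {n : ℕ} (M : Matroid n) where
  open Matroid M

  record TreeDec : Set where
    field
      T : Tree
      τ : Fin n → Tree.Node T

  module _ (D : TreeDec) where
    open TreeDec D
    open Tree T

    preSub : Node → Subset n
    preSub a = Data.Vec.tabulate (λ e → toSide (inSubtree a (τ e)))
      where
        open import Data.Vec
        open import Data.Fin.Subset using (Side; inside; outside)
        toSide : Bool → Side
        toSide true  = inside
        toSide false = outside

    -- Σ_i r(E ∖ F_i) over the components T_i of T - t:
    -- a child c of t gives F = τ⁻¹(subtree c), so E ∖ F = ∁ (preSub c);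
    -- the parent side gives F = E ∖ τ⁻¹(subtree t), so E ∖ F = preSub t.
    compSum : Node → ℤ
    compSum t = sumℤ (map (λ i → + r (∁ (preSub (child i)))) (downEdges t))
              ℤ.+ upPart t
      where
        upPart : Node → ℤ
        upPart Fin.zero    = + 0
        upPart (Fin.suc j) = + r (preSub (Fin.suc j))

    -- width of t = Σ_i r(E∖F_i) - (d-1) r(M), d = number of components
    -- of T - t.  (For the one-node tree, d = 0 and this equals r(M).)
    nodeWidth : Node → ℤ
    nodeWidth t = compSum t - (+ degree t - + 1) ℤ.* + rM M

    width : ℤ
    width = foldr (λ t w → nodeWidth t ⊔ w) (nodeWidth Fin.zero) (allFin (suc m))

  TreeWidthAtLeast : ℕ → Set
  TreeWidthAtLeast k = ∀ (D : TreeDec) → + k ℤ.≤ width D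

{-# OPTIONS --safe #-}
-- Put d A = r(M) − r(E ∖ A). Then d is monotone and supermodular with d ∅ = 0, a star with small
-- sides A₁, …, Aₗ lies in F_k iff r(M) < k + Σ d Aᵢ, and A has order below k iff
-- r(M) < k + d A + d (E ∖ A), so the whole theorem is about d.
--
-- Take a family G of small sets of order below k, closed under subsets of order below k. By
-- induction on the number of sets outside G, either G extends to a tangle or E has an F_k-tree
-- whose leaves may in addition be members of G. If some A and its complement are both outside G,
-- choose minimal sets X ⊆ A and Y ⊆ E ∖ A of order below k outside G, and add each of them to G in
-- turn. Unless this gives a tangle or a tree already, re-rooting the two trees at the new leaf
-- turns them into trees for E ∖ X and E ∖ Y with leaves in G. Among all Z with X ⊆ Z ⊆ E ∖ Y take
-- one of least order: by supermodularity the trees shift to trees for E ∖ Z and Z, which are glued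
-- along Z. Starting from G = {∅} this yields a tangle, or else one tree that serves both as an
-- S_k-tree and as a tree-decomposition of width below k. Conversely a tangle rules out both, since
-- it orients the edges of any such tree and the star at a sink would lie in F_k.
module Submission where

open import Defs
open import Data.Bool using (Bool; true; false)
import Data.Bool.Properties as Bool
open import Data.Empty using (⊥-elim) renaming (⊥ to Absurd)
open import Data.Fin using (Fin; zero; suc; toℕ; fromℕ<)
import Data.Fin as Fin
import Data.Fin.Properties as Fin
open import Data.Fin.Subset
open import Data.Fin.Subset.Properties
open import Data.Integer as ℤ using (ℤ; _⊔_)
import Data.Integer.Properties as ℤ
import Data.Integer.Tactic.RingSolver as ℤ-Solver
open import Data.List using (List; []; _∷_; _++_; map; filter; foldr; length; lookup; allFin)
open import Data.List.Extrema.Nat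
  using (argmin; argmax; argmin-all; argmax-all; f[argmin]≤f[xs]; f[xs]≤f[argmax])
open import Data.List.Membership.Propositional using () renaming (_∈_ to _∈ˡ_)
open import Data.List.Membership.Propositional.Properties
  using (∈-map⁺; ∈-map⁻; ∈-++⁺ˡ; ∈-++⁺ʳ; ∈-filter⁺; ∈-filter⁻; ∈-allFin; ∈-∃++)
open import Data.List.Properties
  using (++-assoc; ++-identityʳ; length-++; map-++; map-∘; map-id; map-cong; map-tabulate;
         tabulate-lookup; filter-++; filter-all; filter-none; filter-notAll; filter-≐)
open import Data.List.Relation.Binary.Permutation.Propositional
  using (_↭_; ↭-refl; ↭-sym; ↭-trans; prep; swap; ↭⇒↭ₛ)
import Data.List.Relation.Binary.Permutation.Propositional.Properties as ↭
open import Data.List.Relation.Binary.Permutation.Setoid.Properties using (AllPairs-resp-↭)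
open import Data.List.Relation.Unary.All as All using (All; []; _∷_)
import Data.List.Relation.Unary.All.Properties as All
open import Data.List.Relation.Unary.AllPairs as AllPairs using (AllPairs; []; _∷_; allPairs?)
import Data.List.Relation.Unary.AllPairs.Properties as AllPairs
open import Data.List.Relation.Unary.Any as Any using (here; there)
open import Data.List.Relation.Unary.Unique.Propositional using (Unique)
import Data.List.Relation.Unary.Unique.Propositional.Properties as Unique
open import Data.Nat as ℕ using (ℕ; zero; suc; _+_; _∸_; _≤_; _<_; _≤?_; _<?_; z≤n; s≤s; s≤s⁻¹)
open import Data.Nat.ListAction using (sum)
open import Data.Nat.ListAction.Properties using (sum-↭)
open import Data.Nat.Properties hiding (_≤?_; _<?_)
open import Data.Nat.Tactic.RingSolver using (solve-∀)
open import Data.Product using (Σ; ∃; ∃₂; _×_; _,_; proj₁; proj₂)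
open import Data.Sum using (_⊎_; inj₁; inj₂; [_,_]′)
open import Data.Unit using (tt) renaming (⊤ to Unit)
import Data.Vec as Vec
open import Data.Vec using ([]; _∷_)
open import Data.Vec.Properties using (≡-dec; lookup∘tabulate; []=⇒lookup; lookup⇒[]=)
open import Function using (_∘_; id)
open import Function.Bundles using (_⇔_; mk⇔; Equivalence)
open import Level using (0ℓ)
open import Relation.Binary.Definitions using (Symmetric)
open import Relation.Binary.PropositionalEquality
open import Relation.Nullary using (¬_; Dec; yes; no; does; contradiction; ¬?; _×-dec_; _⊎-dec_)
open import Relation.Nullary.Decidable using (map′; dec-true)
open import Relation.Unary using (Pred; Decidable; _≐_)

-- Complements, disjoint families and exhaustive search over subsets.

private variable
  n : ℕ
  A B C D : Subset n

_≟ˢ_ : (A B : Subset n) → Dec (A ≡ B)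
_≟ˢ_ = ≡-dec Bool._≟_

∁-involutive : (A : Subset n) → ∁ (∁ A) ≡ A
∁-involutive []      = refl
∁-involutive (x ∷ A) = cong₂ _∷_ (Bool.not-involutive x) (∁-involutive A)

∁⊤≡⊥ : ∁ ⊤ ≡ ⊥ {n}
∁⊤≡⊥ = ⊆-antisym (λ x∈ → contradiction ∈⊤ (x∈∁p⇒x∉p x∈)) ⊥⊆

-- Written as an inclusion because this is the first half of `(A , ∁ A) ≤S (∁ B , B)`, the condition
-- on two members of a star; the other half follows by symmetry.
Disjoint : Subset n → Subset n → Set
Disjoint A B = A ⊆ ∁ B

disjoint-∁ : ∀ (A : Subset n) → Disjoint A (∁ A)
disjoint-∁ A = ⊆-reflexive (sym (∁-involutive A))

disjoint-sym : Disjoint A B → Disjoint B A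
disjoint-sym A⊥B x∈B = x∉p⇒x∈∁p λ x∈A → x∈∁p⇒x∉p (A⊥B x∈A) x∈B

disjoint⇒≢ : Nonempty A → Disjoint A B → A ≢ B
disjoint⇒≢ (_ , x∈A) A⊥B refl = x∈∁p⇒x∉p (A⊥B x∈A) x∈A

nonempty≢∁ : Nonempty A → A ≢ ∁ A
nonempty≢∁ {A = A} (x , x∈A) eq = x∈p⇒x∉∁p x∈A (subst (x ∈_) eq x∈A)

disjoint-∩ : ∀ (U : Subset n) {A B} → Disjoint A B → Disjoint (A ∩ U) (B ∩ U)
disjoint-∩ U {A} {B} A⊥B = p⊆q⇒∁p⊇∁q (p∩q⊆p B U) ∘ A⊥B ∘ p∩q⊆p A U

⊆-∩ : ∀ (U : Subset n) {A B} → A ⊆ B → A ∩ U ⊆ B ∩ U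
⊆-∩ U {A} A⊆B x∈ = let x∈A , x∈U = x∈p∩q⁻ A U x∈ in x∈p∩q⁺ (A⊆B x∈A , x∈U)

∉⋃ : ∀ {x} {σ : List (Subset n)} → All (λ A → x ∉ A) σ → x ∉ ⋃ σ
∉⋃ [] = ∉⊥
∉⋃ {σ = A ∷ σ} (x∉A ∷ h) = [ x∉A , ∉⋃ h ]′ ∘ x∈p∪q⁻ A (⋃ σ)

⋃⊆ : {σ : List (Subset n)} → All (_⊆ B) σ → ⋃ σ ⊆ B
⋃⊆ [] x∈ = ⊥-elim (∉⊥ x∈)
⋃⊆ {σ = A ∷ σ} (h ∷ hs) = [ h , ⋃⊆ hs ]′ ∘ x∈p∪q⁻ A (⋃ σ)

disjoint-⋃ : {σ : List (Subset n)} → All (Disjoint A) σ → Disjoint A (⋃ σ)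
disjoint-⋃ h x∈A = x∉p⇒x∈∁p (∉⋃ (All.map (λ A⊥B → x∈∁p⇒x∉p (A⊥B x∈A)) h))

length≤∣⋃∣ : (σ : List (Subset n)) → AllPairs Disjoint σ → All Nonempty σ → length σ ≤ ∣ ⋃ σ ∣
length≤∣⋃∣ [] _ _ = z≤n
length≤∣⋃∣ (A ∷ σ) (A⊥σ ∷ disj) ((x , x∈A) ∷ ne) = ≤-<-trans (length≤∣⋃∣ σ disj ne)
  (p⊂q⇒∣p∣<∣q∣ (q⊆p∪q A (⋃ σ) , x , p⊆p∪q (⋃ σ) x∈A , x∈∁p⇒x∉p (disjoint-⋃ A⊥σ x∈A)))

AllPairs-disjoint-resp-↭ : {σ τ : List (Subset n)} → σ ↭ τ → AllPairs Disjoint σ → AllPairs Disjoint τ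
AllPairs-disjoint-resp-↭ σ↭τ = AllPairs-resp-↭ (setoid _) (λ {A} {B} → disjoint-sym {A = A} {B})
  ((λ { refl h → h }) , (λ { refl h → h })) (↭⇒↭ₛ σ↭τ)

subsets : ∀ n → List (Subset n)
subsets zero    = [] ∷ []
subsets (suc n) = map (inside ∷_) (subsets n) ++ map (outside ∷_) (subsets n)

∈-subsets : (A : Subset n) → A ∈ˡ subsets n
∈-subsets []            = here refl
∈-subsets (inside ∷ A)  = ∈-++⁺ˡ (∈-map⁺ _ (∈-subsets A))
∈-subsets (outside ∷ A) = ∈-++⁺ʳ _ (∈-map⁺ _ (∈-subsets A))

module _ {P : Pred (Subset n) 0ℓ} (P? : Decidable P) (f : Subset n → ℕ) where

  minimiser : P A → ∃ λ B → P B × (∀ C → P C → f B ≤ f C)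
  minimiser {A} pA = argmin f A σ ,
    argmin-all f pA (All.all-filter P? (subsets n)) ,
    λ C pC → All.lookup (f[argmin]≤f[xs] {f = f} A σ) (∈-filter⁺ P? (∈-subsets C) pC)
    where σ = filter P? (subsets n)

  maximiser : P A → ∃ λ B → P B × (∀ C → P C → f C ≤ f B)
  maximiser {A} pA = argmax f A σ ,
    argmax-all f pA (All.all-filter P? (subsets n)) ,
    λ C pC → All.lookup (f[xs]≤f[argmax] {f = f} A σ) (∈-filter⁺ P? (∈-subsets C) pC)
    where σ = filter P? (subsets n)

anyList? : {P : Pred (List (Subset n)) 0ℓ} → Decidable P → ∀ l → Dec (∃ λ σ → length σ ≤ l × P σ)
anyList? P? zero = map′ (λ p → [] , z≤n , p) (λ { ([] , _ , p) → p }) (P? [])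
anyList? P? (suc l) = map′
  [ (λ p → [] , z≤n , p) , (λ { (A , σ , le , p) → A ∷ σ , s≤s le , p }) ]′
  (λ { ([] , _ , p) → inj₁ p ; (A ∷ σ , le , p) → inj₂ (A , σ , s≤s⁻¹ le , p) })
  (P? [] ⊎-dec anySubset? λ A → anyList? (λ σ → P? (A ∷ σ)) l)

-- Empty sets carry no weight but may repeat in a disjoint list. Once they are dropped, a disjoint
-- list has no repetitions and represents a set.
nonempties : List (Subset n) → List (Subset n)
nonempties = filter nonempty?

filter-map : ∀ {X Y : Set} {P : Y → Set} (P? : Decidable P) (f : X → Y) xs →
  filter P? (map f xs) ≡ map f (filter (P? ∘ f) xs)
filter-map P? f [] = refl
filter-map P? f (x ∷ xs) with P? (f x)
... | yes _ = cong (f x ∷_) (filter-map P? f xs)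
... | no _  = filter-map P? f xs

map-lookup-allFin : ∀ {X : Set} (xs : List X) → map (lookup xs) (allFin (length xs)) ≡ xs
map-lookup-allFin xs = trans (map-tabulate id (lookup xs)) (tabulate-lookup xs)

-- Rooted trees as parent lists.

-- A rooted tree as the list of its non-root nodes in breadth-first order:
-- the entry at position i is the parent and the label of node i + 1.
ParentList : ℕ → Set
ParentList n = List (ℕ × Subset n)

children : ∀ {n} → ℕ → ParentList n → List (Subset n)
children t L = map proj₂ (filter (λ e → proj₁ e ℕ.≟ t) L)

-- Here `q` is the index of the node described by the first entry, so the condition says that
-- parents come before their children.
Increasing : ∀ {n} → ℕ → ParentList n → Set
Increasing q []            = Unit
Increasing q ((p , _) ∷ L) = p < q × Increasing (suc q) L

increasing-lookup : ∀ {n} q (L : ParentList n) → Increasing q L → ∀ i → proj₁ (lookup L i) < q + toℕ i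
increasing-lookup q (_ ∷ L) (p<q , _) zero = subst (_ <_) (sym (+-identityʳ q)) p<q
increasing-lookup q (_ ∷ L) (_ , inc) (suc i) =
  subst (proj₁ (lookup L i) <_) (sym (+-suc q (toℕ i))) (increasing-lookup (suc q) L inc i)

increasing-siblings : ∀ {n} s q (σ : List (Subset n)) L → s < q → Increasing (q + length σ) L →
  Increasing q (map (s ,_) σ ++ L)
increasing-siblings s q [] L s<q inc = subst (λ v → Increasing v L) (+-identityʳ q) inc
increasing-siblings s q (A ∷ σ) L s<q inc = s<q ,
  increasing-siblings s (suc q) σ L (m<n⇒m<1+n s<q) (subst (λ v → Increasing v L) (+-suc q (length σ)) inc)

children-siblings : ∀ {n} s (σ : List (Subset n)) {L} → All (λ e → s < proj₁ e) L →
  children s (map (s ,_) σ ++ L) ≡ σ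
children-siblings s σ {L} later = begin
  map proj₂ (filter P? (map (s ,_) σ ++ L))             ≡⟨ cong (map proj₂) (filter-++ P? (map (s ,_) σ) L) ⟩
  map proj₂ (filter P? (map (s ,_) σ) ++ filter P? L)   ≡⟨ cong₂ (λ xs ys → map proj₂ (xs ++ ys))
                                                             (filter-all P? (All.map⁺ (All.universal (λ _ → refl) σ)))
                                                             (filter-none P? (All.map >⇒≢ later)) ⟩
  map proj₂ (map (s ,_) σ ++ [])                        ≡⟨ cong (map proj₂) (++-identityʳ _) ⟩
  map proj₂ (map (s ,_) σ)                              ≡⟨ map-∘ σ ⟨
  map id σ                                              ≡⟨ map-id σ ⟩
  σ                                                     ∎
  where
  open ≡-Reasoning
  P? = λ e → proj₁ e ℕ.≟ s

children-later : ∀ {n} {s t} (σ : List (Subset n)) {L} → s < t → children t (map (s ,_) σ ++ L) ≡ children t L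
children-later {s = s} {t} σ {L} s<t = begin
  map proj₂ (filter P? (map (s ,_) σ ++ L))             ≡⟨ cong (map proj₂) (filter-++ P? (map (s ,_) σ) L) ⟩
  map proj₂ (filter P? (map (s ,_) σ) ++ filter P? L)   ≡⟨ cong (λ xs → map proj₂ (xs ++ filter P? L))
                                                             (filter-none P? (All.map⁺ (All.universal (λ _ → <⇒≢ s<t) σ))) ⟩
  children t L                                          ∎
  where
  open ≡-Reasoning
  P? = λ e → proj₁ e ℕ.≟ t

-- Weights of disjoint families under a monotone supermodular function.

module Duality {n : ℕ} (d : Subset n → ℕ) (ρ k : ℕ)
  (d-⊥ : d ⊥ ≡ 0)
  (d-mono : ∀ {A B} → A ⊆ B → d A ≤ d B)
  -- Monotonicity is built in: `P` and `Q` may be any supersets of the union and of the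
  -- intersection.
  (d-supermod : ∀ {A B P Q} → A ⊆ P → B ⊆ P → A ∩ B ⊆ Q → d A + d B ≤ d P + d Q)
  where

  weight : List (Subset n) → ℕ
  weight σ = sum (map d σ)

  -- For a matroid this is `ρ` minus the order of `A`, so maximising `w` minimises the order.
  w : Subset n → ℕ
  w A = d A + d (∁ A)

  w-∁ : ∀ A → w (∁ A) ≡ w A
  w-∁ A rewrite ∁-involutive A = +-comm (d (∁ A)) (d A)

  Low : Subset n → Set
  Low A = ρ < k + w A

  low-∁ : ∀ A → Low A → Low (∁ A)
  low-∁ A = subst (λ v → ρ < k + v) (sym (w-∁ A))

  weight-↭ : {σ τ : List (Subset n)} → σ ↭ τ → weight σ ≡ weight τ
  weight-↭ p = sum-↭ (↭.map⁺ d p)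

  weight-nonempties : ∀ σ → weight (nonempties σ) ≡ weight σ
  weight-nonempties [] = refl
  weight-nonempties (A ∷ σ) with nonempty? A
  ... | yes _ = cong (d A +_) (weight-nonempties σ)
  ... | no empty rewrite Empty-unique empty | d-⊥ = weight-nonempties σ

  -- Supermodularity together with `d ⊥ ≡ 0` makes `d` superadditive on disjoint sets.
  weight≤d : {σ : List (Subset n)} → AllPairs Disjoint σ → All (_⊆ B) σ → weight σ ≤ d B
  weight≤d disj sub = ≤-trans (weight≤d⋃ disj) (d-mono (⋃⊆ sub))
    where
    weight≤d⋃ : {σ : List (Subset n)} → AllPairs Disjoint σ → weight σ ≤ d (⋃ σ)
    weight≤d⋃ [] = z≤n
    weight≤d⋃ {A ∷ σ} (A⊥σ ∷ disj) = begin
      d A + weight σ         ≤⟨ +-monoʳ-≤ (d A) (weight≤d⋃ disj) ⟩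
      d A + d (⋃ σ)          ≤⟨ d-supermod {Q = ⊥} (p⊆p∪q (⋃ σ)) (q⊆p∪q A (⋃ σ))
                                  (λ x∈ → let x∈A , x∈σ = x∈p∩q⁻ A (⋃ σ) x∈ in
                                          contradiction x∈σ (x∈∁p⇒x∉p (disjoint-⋃ A⊥σ x∈A))) ⟩
      d (A ∪ ⋃ σ) + d ⊥      ≡⟨ cong (d (A ∪ ⋃ σ) +_) d-⊥ ⟩
      d (A ∪ ⋃ σ) + 0        ≡⟨ +-identityʳ _ ⟩
      d (A ∪ ⋃ σ)            ∎
      where open ≤-Reasoning

  -- The members other than `C` are disjoint subsets of `∁ C`. Consequently every member of a star
  -- in F_k has order below `k`.
  weight≤w : {σ : List (Subset n)} → AllPairs Disjoint σ → C ∈ˡ σ → weight σ ≤ w C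
  weight≤w {C} disj C∈σ with ∈-∃++ C∈σ
  ... | as , bs , refl with AllPairs-disjoint-resp-↭ (↭.shift C as bs) disj
  ... | C⊥ ∷ disj′ = ≤-trans (≤-reflexive (weight-↭ (↭.shift C as bs)))
    (+-monoʳ-≤ (d C) (weight≤d disj′ (All.map (λ {B} → disjoint-sym {A = C} {B}) C⊥)))

  -- Supermodularity is applied to `A` and `U ∪ ⋃ σ`. Their intersection lies in `A ∩ U` because `A`
  -- misses `⋃ σ`, so the members are cut down to `U` one at a time while `U` absorbs them.
  weight-∩ : ∀ U {σ : List (Subset n)} → AllPairs Disjoint σ →
    weight σ + d U ≤ weight (map (_∩ U) σ) + d (U ∪ ⋃ σ)
  weight-∩ U [] = d-mono (p⊆p∪q ⊥)
  weight-∩ U {A ∷ σ} (A⊥σ ∷ disj) = begin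
    (d A + weight σ) + d U                                ≡⟨ +-assoc (d A) (weight σ) (d U) ⟩
    d A + (weight σ + d U)                                ≤⟨ +-monoʳ-≤ (d A) (weight-∩ U disj) ⟩
    d A + (weight (map (_∩ U) σ) + d (U ∪ ⋃ σ))           ≡⟨ swap₁ (d A) (weight (map (_∩ U) σ)) (d (U ∪ ⋃ σ)) ⟩
    weight (map (_∩ U) σ) + (d A + d (U ∪ ⋃ σ))           ≤⟨ +-monoʳ-≤ (weight (map (_∩ U) σ)) (d-supermod ⊆₁ ⊆₂ ⊆₃) ⟩
    weight (map (_∩ U) σ) + (d (U ∪ (A ∪ ⋃ σ)) + d (A ∩ U)) ≡⟨ swap₂ (weight (map (_∩ U) σ)) (d (U ∪ (A ∪ ⋃ σ))) (d (A ∩ U)) ⟩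
    (d (A ∩ U) + weight (map (_∩ U) σ)) + d (U ∪ (A ∪ ⋃ σ)) ∎
    where
    open ≤-Reasoning
    swap₁ : ∀ a b c → a + (b + c) ≡ b + (a + c)
    swap₁ = solve-∀
    swap₂ : ∀ a b c → a + (b + c) ≡ (c + a) + b
    swap₂ = solve-∀
    ⊆₁ : A ⊆ U ∪ (A ∪ ⋃ σ)
    ⊆₁ = q⊆p∪q U _ ∘ p⊆p∪q (⋃ σ)
    ⊆₂ : U ∪ ⋃ σ ⊆ U ∪ (A ∪ ⋃ σ)
    ⊆₂ = [ p⊆p∪q _ , q⊆p∪q U _ ∘ q⊆p∪q A (⋃ σ) ]′ ∘ x∈p∪q⁻ U (⋃ σ)
    ⊆₃ : A ∩ (U ∪ ⋃ σ) ⊆ A ∩ U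
    ⊆₃ x∈ with x∈p∩q⁻ A (U ∪ ⋃ σ) x∈
    ... | x∈A , x∈ with x∈p∪q⁻ U (⋃ σ) x∈
    ... | inj₁ x∈U = x∈p∩q⁺ (x∈A , x∈U)
    ... | inj₂ x∈σ = contradiction x∈σ (x∈∁p⇒x∉p (disjoint-⋃ A⊥σ x∈A))

  -- Stars at the nodes of a tree, and re-rooting at a leaf.

  -- With the outer part ∁ A added, σ is a star in F_k.
  record IsNode (A : Subset n) (σ : List (Subset n)) : Set where
    constructor mkNode
    field
      disjoint : AllPairs Disjoint σ
      inner    : All (_⊆ A) σ
      cost     : ρ < k + (d (∁ A) + weight σ)

    star-disjoint : AllPairs Disjoint (∁ A ∷ σ)
    star-disjoint = All.map p⊆q⇒∁p⊇∁q inner ∷ disjoint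

  open IsNode public

  -- The part behind the edge (A , ∁ A) of an F_k-tree whose leaves may also be members of G.
  data Branch (G : List (Subset n)) : Subset n → Set where
    leaf : A ∈ˡ G → Branch G A
    node : {σ : List (Subset n)} → IsNode A σ → All (Branch G) σ → Branch G A

  IsNode-↭ : {σ τ : List (Subset n)} → σ ↭ τ → IsNode A σ → IsNode A τ
  IsNode-↭ {A} p (mkNode disj sub c) = mkNode (AllPairs-disjoint-resp-↭ p disj) (↭.All-resp-↭ p sub)
    (subst (λ v → ρ < k + (d (∁ A) + v)) (weight-↭ p) c)

  -- The star with members `∁ A`, `C` and `σ` stays the same; only the member regarded as its outer
  -- part changes.
  IsNode-reroot : {σ : List (Subset n)} → IsNode A (C ∷ σ) → IsNode (∁ C) (∁ A ∷ σ)
  IsNode-reroot {A} {C} {σ} (mkNode (C⊥σ ∷ disj) (C⊆A ∷ sub) c) = mkNode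
    (All.map p⊆q⇒∁p⊇∁q sub ∷ disj)
    (p⊆q⇒∁p⊇∁q C⊆A ∷ All.map (λ {B} → disjoint-sym {A = C} {B}) C⊥σ)
    (subst (λ v → ρ < k + v) eq c)
    where
    lemma : ∀ a b c → a + (b + c) ≡ b + (a + c)
    lemma = solve-∀
    eq : d (∁ A) + (d C + weight σ) ≡ d (∁ (∁ C)) + (d (∁ A) + weight σ)
    eq rewrite ∁-involutive C = lemma (d (∁ A)) (d C) (weight σ)

  module _ {G : List (Subset n)} {X : Subset n} (X≢∅ : Nonempty X) where

    -- Describes a branch that uses the leaf `X`: once the far side of its edge is filled in, the
    -- whole tree can be read from `X` outwards.
    Reroot : Subset n → Set
    Reroot A = X ⊆ A × (Branch G (∁ A) → Branch G (∁ X))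

    -- The leaf X lies in at most one branch, since branches are disjoint.
    reroot    : Branch (X ∷ G) A → Branch G A ⊎ Reroot A
    rerootAll : {σ : List (Subset n)} → AllPairs Disjoint σ → All (Branch (X ∷ G)) σ →
      All (Branch G) σ ⊎ ∃₂ λ C σ′ → σ ↭ C ∷ σ′ × Reroot C × All (Branch G) σ′

    reroot (leaf (here refl))  = inj₂ (id , id)
    reroot (leaf (there A∈G)) = inj₁ (leaf A∈G)
    reroot (node st ts) with rerootAll (disjoint st) ts
    ... | inj₁ us = inj₁ (node st us)
    -- The edge towards `X` changes direction: the child `C` becomes the outer part, and the former
    -- outer part `∁ A` becomes a child.
    ... | inj₂ (C , σ′ , p , (X⊆C , f) , us) = let st′ = IsNode-↭ p st in
      inj₂ ((λ x∈X → All.head (inner st′) (X⊆C x∈X)) ,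
            λ t → f (node (IsNode-reroot st′) (t ∷ us)))

    rerootAll _ [] = inj₁ []
    rerootAll {A ∷ _} (A⊥σ ∷ disj) (t ∷ ts) with reroot t | rerootAll disj ts
    ... | inj₁ u  | inj₁ us = inj₁ (u ∷ us)
    ... | inj₂ r  | inj₁ us = inj₂ (_ , _ , ↭-refl , r , us)
    ... | inj₁ u  | inj₂ (C , σ′ , p , r , us) =
      inj₂ (C , A ∷ σ′ , ↭-trans (prep A p) (swap A C ↭-refl) , r , u ∷ us)
    ... | inj₂ (X⊆A , _) | inj₂ (C , σ′ , p , (X⊆C , _) , _) =
      let _ , x∈X = X≢∅ in
      contradiction (X⊆C x∈X) (x∈∁p⇒x∉p (All.head (↭.All-resp-↭ p A⊥σ) (X⊆A x∈X)))

  -- Shifting trees onto a set of least order, and gluing them.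

  Closed : List (Subset n) → Set
  Closed G = ∀ {A B} → A ∈ˡ G → B ⊆ A → Low B → B ∈ˡ G

  module Shift {G : List (Subset n)} (low : ∀ {A} → A ∈ˡ G → Low A) (closed : Closed G)
    {X Z : Subset n} (X⊆Z : X ⊆ Z) (max : ∀ Z′ → X ⊆ Z′ → Z′ ⊆ Z → w Z′ ≤ w Z) where

    -- The shift onto Z turns the outer part ∁ A of a star into ∁ A ∪ Z and an inner part B into B ∖ Z.
    shift-cost : {σ : List (Subset n)} → AllPairs Disjoint σ → All (_⊆ A) σ → X ⊆ ∁ A →
      d (∁ A) + weight σ ≤ d (∁ (A ∩ ∁ Z)) + weight (map (_∩ ∁ Z) σ)
    -- Three inequalities are added: supermodularity for `∁ A` and `Z`, maximality of `w Z` compared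
    -- with `Z′`, and the loss of weight when `σ` is cut down to `∁ Z`. The values of `d` at `Z`,
    -- `Z′` and their complements cancel.
    shift-cost {A} {σ} disj sub X⊆∁A = arith
      (d (∁ A)) (d Z) (d (∁ (A ∩ ∁ Z))) (d Z′) (d (∁ Z′)) (d (∁ Z)) (weight σ) (weight (map (_∩ ∁ Z) σ))
      (d-supermod (p⊆q⇒∁p⊇∁q (p∩q⊆p A (∁ Z))) Z⊆ (λ x∈ → let x∈∁A , x∈Z = x∈p∩q⁻ (∁ A) Z x∈ in x∈p∩q⁺ (x∈Z , x∈∁A)))
      (max Z′ (λ x∈X → x∈p∩q⁺ (X⊆Z x∈X , X⊆∁A x∈X)) (p∩q⊆p Z (∁ A)))
      (≤-trans (weight-∩ (∁ Z) disj) (+-monoʳ-≤ (weight (map (_∩ ∁ Z) σ)) (d-mono ⊆∁Z′)))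
      where
      Z′ = Z ∩ ∁ A
      Z⊆ : Z ⊆ ∁ (A ∩ ∁ Z)
      Z⊆ x∈Z = x∉p⇒x∈∁p λ x∈ → x∈∁p⇒x∉p (p∩q⊆q A (∁ Z) x∈) x∈Z
      ⊆∁Z′ : ∁ Z ∪ ⋃ σ ⊆ ∁ Z′
      ⊆∁Z′ x∈ = x∉p⇒x∈∁p λ x∈Z′ → let x∈Z , x∈∁A = x∈p∩q⁻ Z (∁ A) x∈Z′ in
        [ (λ x∈∁Z → x∈∁p⇒x∉p x∈∁Z x∈Z) , (λ x∈σ → x∈∁p⇒x∉p x∈∁A (⋃⊆ sub x∈σ)) ]′ (x∈p∪q⁻ (∁ Z) (⋃ σ) x∈)
      arith : ∀ a z b z′ c′ c s s′ → a + z ≤ b + z′ → z′ + c′ ≤ z + c → s + c ≤ s′ + c′ → a + s ≤ b + s′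
      arith a z b z′ c′ c s s′ p q r = +-cancelʳ-≤ (z + z′ + (c + c′)) (a + s) (b + s′)
        (subst₂ _≤_ (l a z z′ c′ s c) (m b z′ z c s′ c′) (+-mono-≤ (+-mono-≤ p q) r))
        where
        l : ∀ a z z′ c′ s c → ((a + z) + (z′ + c′)) + (s + c) ≡ (a + s) + (z + z′ + (c + c′))
        l = solve-∀
        m : ∀ b z′ z c s′ c′ → ((b + z′) + (z + c)) + (s′ + c′) ≡ (b + s′) + (z + z′ + (c + c′))
        m = solve-∀

    -- This is the cost estimate for the one-element star `A ∷ []`, whose total weight with its
    -- outer part is `w A`.
    shift-low : Low A → X ⊆ ∁ A → Low (A ∩ ∁ Z)
    shift-low {A} lowA X⊆∁A = <-≤-trans lowA (+-monoʳ-≤ k (subst₂ _≤_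
      (e (d (∁ A)) (d A)) (e (d (∁ (A ∩ ∁ Z))) (d (A ∩ ∁ Z)))
      (shift-cost {σ = A ∷ []} ([] ∷ []) (id ∷ []) X⊆∁A)))
      where
      e : ∀ a b → a + (b + 0) ≡ b + a
      e = solve-∀

    ⊆-⊆∁ : X ⊆ ∁ A → B ⊆ A → X ⊆ ∁ B
    ⊆-⊆∁ X⊆∁A B⊆A = p⊆q⇒∁p⊇∁q B⊆A ∘ X⊆∁A

    shift-∩∁  : Branch G A → X ⊆ ∁ A → Branch G (A ∩ ∁ Z)
    shifts : {σ : List (Subset n)} → All (Branch G) σ → All (λ A → X ⊆ ∁ A) σ → All (Branch G) (map (_∩ ∁ Z) σ)

    -- A shifted leaf is a subset of the old one and still of low order, so closure keeps it in `G`.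
    shift-∩∁ (leaf A∈G) X⊆∁A = leaf (closed A∈G (p∩q⊆p _ (∁ Z)) (shift-low (low A∈G) X⊆∁A))
    shift-∩∁ (node (mkNode disj sub c) ts) X⊆∁A = node
      (mkNode
        (AllPairs.map⁺ {f = _∩ ∁ Z} (AllPairs.map (λ {B} {C} → disjoint-∩ (∁ Z) {B} {C}) disj))
        (All.map⁺ {f = _∩ ∁ Z} (All.map (λ {B} → ⊆-∩ (∁ Z) {B}) sub))
        (<-≤-trans c (+-monoʳ-≤ k (shift-cost disj sub X⊆∁A))))
      (shifts ts (All.map (λ {B} → ⊆-⊆∁ {B = B} X⊆∁A) sub))

    shifts [] [] = []
    shifts (t ∷ ts) (h ∷ hs) = shift-∩∁ t h ∷ shifts ts hs

    shift-∁ : Branch G (∁ X) → Branch G (∁ Z)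
    shift-∁ t = subst (Branch G)
      (⊆-antisym (p∩q⊆q (∁ X) (∁ Z)) (λ x∈ → x∈p∩q⁺ (p⊆q⇒∁p⊇∁q X⊆Z x∈ , x∈)))
      (shift-∩∁ t (disjoint-∁ X))

  -- The parts `Z` and `∁ Z` together weigh `w Z`, so `Low Z` pays for the node that joins the two
  -- branches.
  glue : {G : List (Subset n)} {Z : Subset n} → Low Z → Branch G Z → Branch G (∁ Z) → Branch G ⊤
  glue {Z = Z} lowZ t u = node (mkNode
    ((disjoint-∁ Z ∷ []) ∷ [] ∷ [])
    (⊆⊤ ∷ ⊆⊤ ∷ [])
    (<-≤-trans lowZ (+-monoʳ-≤ k (≤-trans (≤-reflexive (cong (d Z +_) (sym (+-identityʳ _)))) (m≤n+m _ (d (∁ ⊤)))))))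
    (t ∷ u ∷ [])

  combine : {G : List (Subset n)} {X Y : Subset n} → (∀ {A} → A ∈ˡ G → Low A) → Closed G →
    X ⊆ ∁ Y → Low X → Branch G (∁ X) → Branch G (∁ Y) → Branch G ⊤
  combine {G} {X} {Y} low closed X⊆∁Y lowX t u
    with maximiser (λ Z → X ⊆? Z ×-dec Z ⊆? ∁ Y) w {A = X} (id , X⊆∁Y)
  ... | Z , (X⊆Z , Z⊆∁Y) , max = glue
    (<-≤-trans lowX (+-monoʳ-≤ k (max X (id , X⊆∁Y))))
    (subst (Branch G) (∁-involutive Z) (Shift.shift-∁ low closed Y⊆∁Z max′ u))
    (Shift.shift-∁ low closed X⊆Z (λ Z′ X⊆Z′ Z′⊆Z → max Z′ (X⊆Z′ , Z⊆∁Y ∘ Z′⊆Z)) t)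
    where
    Y⊆∁Z : Y ⊆ ∁ Z
    Y⊆∁Z = disjoint-sym {A = Z} Z⊆∁Y
    -- Complements of sets between `Y` and `∁ Z` lie between `X` and `∁ Y`, and `w` is invariant
    -- under complement. Hence one `Z` serves both shifts.
    max′ : ∀ Z′ → Y ⊆ Z′ → Z′ ⊆ ∁ Z → w Z′ ≤ w (∁ Z)
    max′ Z′ Y⊆Z′ Z′⊆∁Z = subst₂ _≤_ (w-∁ Z′) (sym (w-∁ Z))
      (max (∁ Z′) (disjoint-sym {A = Z′} Z′⊆∁Z ∘ X⊆Z , p⊆q⇒∁p⊇∁q Y⊆Z′))

  -- Enlarging a family of small sets until a tangle or a tree appears.

  StarIn : List (Subset n) → List (Subset n) → Set
  StarIn G σ = AllPairs Disjoint σ × All (_∈ˡ G) σ × ρ < k + weight σ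

  record IsSmall (G : List (Subset n)) : Set where
    field
      low    : ∀ {A} → A ∈ˡ G → Low A
      closed : Closed G

  -- `G` lists the small sides of a tangle. Consistency is derived from `closed` together with
  -- `starFree`, which forbids a low set and its complement from both being small.
  record IsSmallTangle (G : List (Subset n)) : Set where
    field
      isSmall  : IsSmall G
      total    : ∀ A → Low A → A ∈ˡ G ⊎ ∁ A ∈ˡ G
      starFree : ∀ σ → ¬ StarIn G σ

  _∈?ˡ_ : (A : Subset n) (G : List (Subset n)) → Dec (A ∈ˡ G)
  A ∈?ˡ G = Any.any? (A ≟ˢ_) G

  low? : Decidable Low
  low? A = ρ <? k + w A

  nonemptyStar : {G σ : List (Subset n)} → StarIn G σ → StarIn G (nonempties σ)
  nonemptyStar {σ = σ} (disj , all , c) = AllPairs.filter⁺ nonempty? disj , All.filter⁺ nonempty? all ,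
    subst (λ v → ρ < k + v) (sym (weight-nonempties σ)) c

  star⇒tree : {G σ : List (Subset n)} → StarIn G σ → Branch G ⊤
  star⇒tree (disj , all , c) = node (mkNode disj (All.universal ⊆-max _)
    (<-≤-trans c (+-monoʳ-≤ k (m≤n+m _ (d (∁ ⊤)))))) (All.map leaf all)

  starFree? : ∀ G → Branch G ⊤ ⊎ (∀ σ → ¬ StarIn G σ)
  starFree? G with anyList? (λ σ →
    allPairs? (λ A B → A ⊆? ∁ B) σ ×-dec All.all? (_∈?ˡ G) σ ×-dec ρ <? k + weight σ) n
  ... | yes (σ , _ , st) = inj₁ (star⇒tree st)
  ... | no ¬st = inj₂ λ σ st → let st′ = nonemptyStar st in
    ¬st (nonempties σ ,
      ≤-trans (length≤∣⋃∣ (nonempties σ) (proj₁ st′) (All.all-filter nonempty? σ)) (∣p∣≤n (⋃ (nonempties σ))) ,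
      st′)

  -- The field `minimal` is what keeps the family closed after `X` has been added.
  record Addable (G : List (Subset n)) (A X : Subset n) : Set where
    field
      X⊆A     : X ⊆ A
      low     : Low X
      new     : ¬ (X ∈ˡ G)
      minimal : ∀ {B} → B ⊆ X → Low B → B ≡ X ⊎ B ∈ˡ G

  addable : ∀ {G} → Low A → ¬ (A ∈ˡ G) → ∃ (Addable G A)
  addable {A} {G} lowA A∉G
    with minimiser (λ B → B ⊆? A ×-dec low? B ×-dec ¬? (B ∈?ˡ G)) ∣_∣ {A = A} (id , lowA , A∉G)
  ... | X , (X⊆A , lowX , X∉G) , min = X , record
    { X⊆A = X⊆A ; low = lowX ; new = X∉G ; minimal = minimal }
    where
    minimal : ∀ {B} → B ⊆ X → Low B → B ≡ X ⊎ B ∈ˡ G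
    minimal {B} B⊆X lowB with B ∈?ˡ G | X ⊆? B
    ... | yes B∈G | _ = inj₂ B∈G
    ... | no _ | yes X⊆B = inj₁ (⊆-antisym B⊆X X⊆B)
    ... | no B∉G | no X⊈B = contradiction (min B (X⊆A ∘ B⊆X , lowB , B∉G)) (<⇒≱ (p⊂q⇒∣p∣<∣q∣ (B⊆X , strict)))
      where
      strict : ∃ λ x → x ∈ X × x ∉ B
      strict with nonempty? (X ∩ ∁ B)
      ... | yes (x , x∈) = let x∈X , x∈∁B = x∈p∩q⁻ X (∁ B) x∈ in x , x∈X , x∈∁p⇒x∉p x∈∁B
      ... | no empty = ⊥-elim (X⊈B λ x∈X → x∉∁p⇒x∈p λ x∈∁B → empty (_ , x∈p∩q⁺ (x∈X , x∈∁B)))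

  add-isSmall : ∀ {G X} → IsSmall G → Addable G A X → IsSmall (X ∷ G)
  add-isSmall small add = record
    { low    = λ { (here refl) → Addable.low add ; (there A∈G) → IsSmall.low small A∈G }
    ; closed = λ
      { (here refl) B⊆X lowB → [ here , there ]′ (Addable.minimal add B⊆X lowB)
      ; (there A∈G) B⊆A lowB → there (IsSmall.closed small A∈G B⊆A lowB) } }

  undecided? : ∀ G → (∃ λ A → Low A × ¬ (A ∈ˡ G) × ¬ (∁ A ∈ˡ G)) ⊎ (∀ A → Low A → A ∈ˡ G ⊎ ∁ A ∈ˡ G)
  undecided? G with anySubset? (λ A → low? A ×-dec ¬? (A ∈?ˡ G) ×-dec ¬? (∁ A ∈?ˡ G))
  ... | yes u = inj₁ u
  ... | no ¬u = inj₂ total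
    where
    total : ∀ A → Low A → A ∈ˡ G ⊎ ∁ A ∈ˡ G
    total A lowA with A ∈?ˡ G | ∁ A ∈?ˡ G
    ... | yes A∈G | _ = inj₁ A∈G
    ... | no _ | yes ∁A∈G = inj₂ ∁A∈G
    ... | no A∉G | no ∁A∉G = contradiction (A , lowA , A∉G , ∁A∉G) ¬u

  -- U lists the sets that may still be added to G.
  duality-above : ∀ m G U → length U ≤ m → (∀ A → A ∈ˡ G ⊎ A ∈ˡ U) → ⊥ ∈ˡ G → IsSmall G →
    Branch G ⊤ ⊎ ∃ IsSmallTangle
  add-or-reroot : ∀ m G U → length U ≤ m → (∀ A → A ∈ˡ G ⊎ A ∈ˡ U) → ⊥ ∈ˡ G → IsSmall G →
    ∀ {A X} → Addable G A X → Branch G ⊤ ⊎ Branch G (∁ X) ⊎ ∃ IsSmallTangle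

  add-or-reroot m G U U≤m cover ⊥∈G small {A} {X} add with cover X
  ... | inj₁ X∈G = contradiction X∈G (Addable.new add)
  add-or-reroot zero G [] U≤m cover ⊥∈G small add | inj₂ ()
  add-or-reroot (suc m) G U U≤m cover ⊥∈G small {A} {X} add | inj₂ X∈U
    with duality-above m (X ∷ G) (filter (λ B → ¬? (B ≟ˢ X)) U)
      (s≤s⁻¹ (≤-trans (filter-notAll _ U (Any.map (λ { refl ¬p → ¬p refl }) X∈U)) U≤m))
      cover′ (there ⊥∈G) (add-isSmall small add)
    where
    cover′ : ∀ B → B ∈ˡ X ∷ G ⊎ B ∈ˡ filter (λ B → ¬? (B ≟ˢ X)) U
    cover′ B with B ≟ˢ X | cover B
    ... | yes refl | _ = inj₁ (here refl)
    ... | no _ | inj₁ B∈G = inj₁ (there B∈G)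
    ... | no B≢X | inj₂ B∈U = inj₂ (∈-filter⁺ (λ B → ¬? (B ≟ˢ X)) B∈U B≢X)
  ... | inj₂ tangle = inj₂ (inj₂ tangle)
  ... | inj₁ t with nonempty? X
  ... | no empty = contradiction (subst (_∈ˡ G) (sym (Empty-unique empty)) ⊥∈G) (Addable.new add)
  ... | yes X≢∅ with reroot X≢∅ t
  ... | inj₁ u = inj₁ u
  -- To re-root a tree for `⊤`, a branch for `∁ ⊤` must be supplied; this set is empty, hence a leaf
  -- in `G`.
  ... | inj₂ (_ , f) = inj₂ (inj₁ (f (leaf (subst (_∈ˡ G) (sym ∁⊤≡⊥) ⊥∈G))))

  duality-above m G U U≤m cover ⊥∈G small with undecided? G
  ... | inj₂ total =
    [ inj₁ , (λ free → inj₂ (G , record { isSmall = small ; total = total ; starFree = free })) ]′ (starFree? G)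
  ... | inj₁ (A , lowA , A∉G , ∁A∉G) with addable lowA A∉G | addable (low-∁ A lowA) ∁A∉G
  ... | X , addX | Y , addY
    with add-or-reroot m G U U≤m cover ⊥∈G small addX | add-or-reroot m G U U≤m cover ⊥∈G small addY
  ... | inj₁ t | _ = inj₁ t
  ... | _ | inj₁ t = inj₁ t
  ... | inj₂ (inj₂ tangle) | _ = inj₂ tangle
  ... | _ | inj₂ (inj₂ tangle) = inj₂ tangle
  ... | inj₂ (inj₁ t) | inj₂ (inj₁ u) = inj₁ (combine (IsSmall.low small) (IsSmall.closed small)
    (p⊆q⇒∁p⊇∁q (Addable.X⊆A addY) ∘ disjoint-∁ A ∘ Addable.X⊆A addX)
    (Addable.low addX) t u)

  duality : Low ⊥ → Branch (⊥ ∷ []) ⊤ ⊎ ∃ IsSmallTangle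
  duality low-⊥ = duality-above (length (subsets n)) (⊥ ∷ []) (subsets n) ≤-refl
    (inj₂ ∘ ∈-subsets) (here refl) (record
    { low    = λ { (here refl) → low-⊥ }
    ; closed = λ { (here refl) B⊆⊥ _ → here (⊆-antisym B⊆⊥ ⊥⊆) } })

  -- Trees without leaves in a family.

  data Decomposition (A : Subset n) : Set where
    node : {σ : List (Subset n)} → IsNode A σ → All Nonempty σ → All Decomposition σ → Decomposition A

  -- Over `⊥ ∷ []` every leaf is empty, so removing the empty parts removes the leaves and also
  -- makes the sets below a node distinct.
  prune    : ∀ {A} → Low ⊥ → Branch (⊥ ∷ []) A → Decomposition A
  pruneAll : {σ : List (Subset n)} → Low ⊥ → All (Branch (⊥ ∷ [])) σ → All Decomposition (nonempties σ)

  -- Leaves below a node are dropped by `pruneAll`, so here the leaf is the whole branch. It becomes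
  -- a node without children, whose cost condition is `Low ⊥`.
  prune low-⊥ (leaf (here refl)) = node (mkNode [] [] (subst (λ v → ρ < k + v) eq low-⊥)) [] []
    where
    eq : d ⊥ + d (∁ ⊥) ≡ d (∁ ⊥) + 0
    eq rewrite d-⊥ = sym (+-identityʳ _)
  prune low-⊥ (node {A = A} {σ} (mkNode disj sub c) ts) = node
    (mkNode (AllPairs.filter⁺ nonempty? disj) (All.filter⁺ nonempty? sub)
      (subst (λ v → ρ < k + (d (∁ A) + v)) (sym (weight-nonempties σ)) c))
    (All.all-filter nonempty? σ)
    (pruneAll low-⊥ ts)

  pruneAll low-⊥ [] = []
  pruneAll {A ∷ σ} low-⊥ (t ∷ ts) with nonempty? A
  ... | yes _ = prune low-⊥ t ∷ pruneAll low-⊥ ts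
  ... | no _  = pruneAll low-⊥ ts

  size  : ∀ {A} → Decomposition A → ℕ
  sizes : {σ : List (Subset n)} → All Decomposition σ → ℕ
  size (node _ _ ts) = suc (sizes ts)
  sizes []       = 0
  sizes (t ∷ ts) = size t + sizes ts

  sizes-++ : {σ τ : List (Subset n)} (ts : All Decomposition σ) (us : All Decomposition τ) →
    sizes (All.++⁺ ts us) ≡ sizes ts + sizes us
  sizes-++ [] us = refl
  sizes-++ (t ∷ ts) us = trans (cong (size t +_) (sizes-++ ts us)) (sym (+-assoc (size t) (sizes ts) (sizes us)))

  -- Breadth-first numbering of the nodes.

  NodeAt : ParentList n → ℕ → Subset n → Set
  NodeAt L t A = IsNode A (children t L) × All Nonempty (children t L)

  NodesFrom : ℕ → List (Subset n) → ParentList n → Set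
  NodesFrom s []       L = Unit
  NodesFrom s (A ∷ As) L = NodeAt L s A × NodesFrom (suc s) As L

  nodesFrom-later : ∀ {s t} σ {L} As → s < t → NodesFrom t As L → NodesFrom t As (map (s ,_) σ ++ L)
  nodesFrom-later σ [] s<t _ = tt
  nodesFrom-later σ (A ∷ As) s<t (h , hs) =
    subst (λ τ → IsNode A τ × All Nonempty τ) (sym (children-later σ s<t)) h , nodesFrom-later σ As (m<n⇒m<1+n s<t) hs

  nodesFrom-lookup : ∀ {s L} (K : ParentList n) → NodesFrom s (map proj₂ K) L →
    ∀ i → NodeAt L (s + toℕ i) (proj₂ (lookup K i))
  nodesFrom-lookup {s} {L} (e ∷ K) (h , _) zero = subst (λ v → NodeAt L v (proj₂ e)) (sym (+-identityʳ s)) h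
  nodesFrom-lookup {s} {L} (e ∷ K) (_ , hs) (suc i) =
    subst (λ v → NodeAt L v (proj₂ (lookup K i))) (sym (+-suc s (toℕ i))) (nodesFrom-lookup K hs i)

  -- s is the index of the first pending node; the pending nodes are As.
  breadthFirst : ∀ m s {As} (ts : All Decomposition As) → sizes ts ≤ m →
    ∃ λ L → NodesFrom s (As ++ map proj₂ L) L × Increasing (s + length As) L × All (λ e → s ≤ proj₁ e) L
  breadthFirst m s [] _ = [] , tt , tt , []
  breadthFirst (suc m) s {A ∷ As} (node {σ} isNode ne us ∷ ts) size≤m
    with breadthFirst m (suc s) (All.++⁺ ts us)
      (≤-trans (≤-reflexive (trans (sizes-++ ts us) (+-comm (sizes ts) (sizes us)))) (s≤s⁻¹ size≤m))
  -- The children of node `s` join the end of the queue, so their entries precede those still to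
  -- come. All later entries have parents after `s`, hence node `s` gains no further children.
  ... | L , nodes , inc , later = map (s ,_) σ ++ L ,
    (subst (λ τ → IsNode A τ × All Nonempty τ) (sym (children-siblings s σ later)) (isNode , ne) ,
     nodesFrom-later σ (As ++ map proj₂ (map (s ,_) σ ++ L)) ≤-refl (subst (λ τ → NodesFrom (suc s) τ L) eq nodes)) ,
    increasing-siblings s (s + suc (length As)) σ L (m<m+n s (s≤s z≤n))
      (subst (λ v → Increasing v L) eq′ inc) ,
    All.++⁺ (All.map⁺ (All.universal (λ _ → ≤-refl) σ)) (All.map <⇒≤ later)
    where
    open ≡-Reasoning
    eq : (As ++ σ) ++ map proj₂ L ≡ As ++ map proj₂ (map (s ,_) σ ++ L)
    eq = begin
      (As ++ σ) ++ map proj₂ L                        ≡⟨ ++-assoc As σ _ ⟩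
      As ++ (σ ++ map proj₂ L)                        ≡⟨ cong (λ τ → As ++ (τ ++ map proj₂ L)) (trans (sym (map-id σ)) (map-∘ σ)) ⟩
      As ++ (map proj₂ (map (s ,_) σ) ++ map proj₂ L) ≡⟨ cong (As ++_) (map-++ proj₂ (map (s ,_) σ) L) ⟨
      As ++ map proj₂ (map (s ,_) σ ++ L)             ∎
    eq′ : suc s + length (As ++ σ) ≡ s + suc (length As) + length σ
    eq′ = begin
      suc s + length (As ++ σ)          ≡⟨ cong (suc s +_) (length-++ As) ⟩
      suc s + (length As + length σ)    ≡⟨ +-assoc (suc s) (length As) (length σ) ⟨
      suc s + length As + length σ      ≡⟨ cong (_+ length σ) (+-suc s (length As)) ⟨
      s + suc (length As) + length σ    ∎

  -- The common form of S_k-trees and tree-decompositions: `set t` is the side of the edge above `t`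
  -- that faces away from the root.
  record TreeLayout : Set where
    field
      T    : Tree
    open Tree T public
    field
      set  : Node → Subset n
      root : set zero ≡ ⊤
    branches : Node → List (Subset n)
    branches t = map (set ∘ child) (downEdges t)
    field
      isNode : ∀ t → IsNode (set t) (branches t)

  layout : Decomposition ⊤ → Σ TreeLayout λ 𝓛 → ∀ t → All Nonempty (TreeLayout.branches 𝓛 t)
  layout t with breadthFirst _ 0 (t ∷ []) ≤-refl
  ... | L , (rootNode , nodes) , inc , _ = record
      { T = T ; set = set ; root = refl ; isNode = λ t → subst (IsNode (set t)) (sym (branches≡ t)) (proj₁ (nodeAt t)) } ,
      λ t → subst (All Nonempty) (sym (branches≡ t)) (proj₂ (nodeAt t))
    where
    parent< : ∀ i → proj₁ (lookup L i) < suc (toℕ i)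
    parent< = increasing-lookup 1 L inc
    T : Tree
    T = record
      { m = length L
      ; par = λ i → fromℕ< (<-≤-trans (parent< i) (s≤s (<⇒≤ (Fin.toℕ<n i))))
      ; par-lt = λ i → ≤-trans (≤-reflexive (Fin.toℕ-fromℕ< _)) (s≤s⁻¹ (parent< i))
      }
    open Tree T using (Node; par; downEdges)
    set : Node → Subset n
    set zero    = ⊤
    set (suc i) = proj₂ (lookup L i)
    nodeAt : ∀ t → NodeAt L (toℕ t) (set t)
    nodeAt zero    = rootNode
    nodeAt (suc i) = nodesFrom-lookup L nodes i
    branches≡ : ∀ t → map (set ∘ suc) (downEdges t) ≡ children (toℕ t) L
    branches≡ t = begin
      map (proj₂ ∘ lookup L) (downEdges t)                        ≡⟨ cong (map (proj₂ ∘ lookup L))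
                                                                      (filter-≐ _ (P? ∘ lookup L) same-parent (allFin _)) ⟩
      map (proj₂ ∘ lookup L) (filter (P? ∘ lookup L) (allFin _))  ≡⟨ map-∘ _ ⟩
      map proj₂ (map (lookup L) (filter (P? ∘ lookup L) (allFin _))) ≡⟨ cong (map proj₂) (filter-map P? (lookup L) (allFin _)) ⟨
      map proj₂ (filter P? (map (lookup L) (allFin _)))           ≡⟨ cong (map proj₂ ∘ filter P?) (map-lookup-allFin L) ⟩
      children (toℕ t) L                                          ∎
      where
      open ≡-Reasoning
      P? = λ (e : ℕ × Subset n) → proj₁ e ℕ.≟ toℕ t
      same-parent : (λ i → par i ≡ t) ≐ (λ i → proj₁ (lookup L i) ≡ toℕ t)
      same-parent = (λ eq → trans (sym (Fin.toℕ-fromℕ< _)) (cong toℕ eq)) ,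
                    (λ eq → Fin.toℕ-injective (trans (Fin.toℕ-fromℕ< _) eq))

-- Opened only here, because it makes sections of _+_ ambiguous.
open import Data.Integer using (+_)

-- Lists of related pairs, maxima and integer inequalities.

AllPairs-lookup : ∀ {X : Set} {R : X → X → Set} → Symmetric R → ∀ {xs x y} →
  AllPairs R xs → x ∈ˡ xs → y ∈ˡ xs → x ≢ y → R x y
AllPairs-lookup sym-R (r ∷ rs) (here refl) (here refl) x≢y = contradiction refl x≢y
AllPairs-lookup sym-R (r ∷ rs) (here refl) (there y∈) _    = All.lookup r y∈
AllPairs-lookup sym-R (r ∷ rs) (there x∈) (here refl) _    = sym-R (All.lookup r x∈)
AllPairs-lookup sym-R (r ∷ rs) (there x∈) (there y∈) x≢y   = AllPairs-lookup sym-R rs x∈ y∈ x≢y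

AllPairs-unique : ∀ {X : Set} {R : X → X → Set} {xs} → Unique xs →
  (∀ x y → x ∈ˡ xs → y ∈ˡ xs → x ≢ y → R x y) → AllPairs R xs
AllPairs-unique [] _ = []
AllPairs-unique (x≢ ∷ unique) h =
  All.tabulate (λ y∈ → h _ _ (here refl) (there y∈) (All.lookup x≢ y∈)) ∷
  AllPairs-unique unique (λ x y x∈ y∈ → h x y (there x∈) (there y∈))

last : ∀ {m} {P : Fin m → Set} → (∀ i → Dec (P i)) →
  (∀ i → ¬ P i) ⊎ ∃ λ j → P j × (∀ i → j Fin.< i → ¬ P i)
last {zero} P? = inj₁ λ ()
last {suc m} P? with last (P? ∘ suc)
... | inj₂ (j , p , max) = inj₂ (suc j , p , λ { (suc i) j<i → max i (s≤s⁻¹ j<i) })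
... | inj₁ none with P? zero
... | yes p = inj₂ (zero , p , λ { (suc i) _ → none i })
... | no ¬p = inj₁ λ { zero → ¬p ; (suc i) → none i }

does-true : ∀ {P : Set} (P? : Dec P) → does P? ≡ true → P
does-true (yes p) _ = p

foldr-⊔-< : ∀ {X : Set} (f : X → ℤ) {u k} xs → u ℤ.< k → (∀ x → f x ℤ.< k) → foldr (λ x v → f x ⊔ v) u xs ℤ.< k
foldr-⊔-< f [] u<k _ = u<k
foldr-⊔-< f {u} {k} (x ∷ xs) u<k h = [ (λ eq → subst (ℤ._< k) (sym eq) (h x)) ,
    (λ eq → subst (ℤ._< k) (sym eq) (foldr-⊔-< f xs u<k h)) ]′
  (ℤ.⊔-sel (f x) (foldr (λ x v → f x ⊔ v) u xs))

≤-foldr-⊔ : ∀ {X : Set} (f : X → ℤ) {u x xs} → x ∈ˡ xs → f x ℤ.≤ foldr (λ x v → f x ⊔ v) u xs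
≤-foldr-⊔ f (here refl) = ℤ.i≤i⊔j _ _
≤-foldr-⊔ f (there x∈)  = ℤ.i≤j⇒i≤k⊔j _ (≤-foldr-⊔ f x∈)

a-b<c⇒a<c+b : ∀ a b c → + a ℤ.- + b ℤ.< + c → a < c + b
a-b<c⇒a<c+b a b c h = ℤ.drop‿+<+ (subst (ℤ._< + (c + b)) (cancel (+ a) (+ b)) (ℤ.+-monoˡ-< (+ b) h))
  where
  cancel : ∀ x y → (x ℤ.- y) ℤ.+ y ≡ x
  cancel = ℤ-Solver.solve-∀

a<c+b⇒a-b<c : ∀ a b c → a < c + b → + a ℤ.- + b ℤ.< + c
a<c+b⇒a-b<c a b c h = subst (+ a ℤ.- + b ℤ.<_) (cancel (+ c) (+ b)) (ℤ.+-monoˡ-< (ℤ.- + b) (ℤ.+<+ h))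
  where
  cancel : ∀ x y → (x ℤ.+ y) ℤ.- y ≡ x
  cancel = ℤ-Solver.solve-∀

sep : ∀ {n} → Subset n → Sep n
sep A = A , ∁ A

inv-sep : ∀ {n} (A : Subset n) → inv (sep A) ≡ sep (∁ A)
inv-sep A = cong (∁ A ,_) (sym (∁-involutive A))

disjoint-unique : ∀ {n} {σ : List (Subset n)} → AllPairs Disjoint σ → All Nonempty σ → Unique σ
disjoint-unique [] [] = []
disjoint-unique {σ = A ∷ _} (A⊥σ ∷ disj) (A≢∅ ∷ ne) =
  All.map (λ {B} → disjoint⇒≢ {A = A} {B} A≢∅) A⊥σ ∷ disjoint-unique disj ne

-- The ancestor order of a tree.

module Ancestors (T : Tree) where
  open Tree T

  data _≼_ (a : Node) : Node → Set where
    here : a ≼ a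
    up   : ∀ {i} → a ≼ par i → a ≼ suc i

  ≼⇒≤ : ∀ {a x} → a ≼ x → toℕ a ≤ toℕ x
  ≼⇒≤ here       = ≤-refl
  ≼⇒≤ (up {i} p) = ≤-trans (≼⇒≤ p) (m≤n⇒m≤1+n (par-lt i))

  zero≼ : ∀ m x → toℕ x ≤ m → zero ≼ x
  zero≼ _ zero _ = here
  zero≼ (suc m) (suc i) i<m = up (zero≼ m (par i) (≤-trans (par-lt i) (s≤s⁻¹ i<m)))

  ≼-trans : ∀ {a b x} → a ≼ b → b ≼ x → a ≼ x
  ≼-trans p here   = p
  ≼-trans p (up q) = up (≼-trans p q)

  ≼-comparable : ∀ {a b x} → a ≼ x → b ≼ x → a ≼ b ⊎ b ≼ a
  ≼-comparable here q = inj₂ q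
  ≼-comparable p here = inj₁ p
  ≼-comparable (up p) (up q) = ≼-comparable p q

  ≼-child : ∀ {a x} → a ≼ x → a ≢ x → ∃ λ i → par i ≡ a × suc i ≼ x
  ≼-child here a≢a = contradiction refl a≢a
  ≼-child {a} (up {i} p) _ with a Fin.≟ par i
  ... | yes refl = i , refl , here
  ... | no a≢ = let j , eq , q = ≼-child p a≢ in j , eq , up q

  siblings-⋠ : ∀ {i j} → par i ≡ par j → i ≢ j → ¬ suc i ≼ suc j
  siblings-⋠ eq i≢j here = i≢j refl
  siblings-⋠ {i} eq i≢j (up p) = <⇒≱ (≼⇒≤ p) (subst (λ x → toℕ x ≤ toℕ i) eq (par-lt i))

  ancF⇒≼ : ∀ f a x → ancF f a x ≡ true → a ≼ x
  ancF⇒≼ f a x h with a Fin.≟ x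
  ancF⇒≼ f a x h | yes refl = here
  ancF⇒≼ zero a x () | no _
  ancF⇒≼ (suc f) a zero () | no _
  ancF⇒≼ (suc f) a (suc i) h | no _ = up (ancF⇒≼ f a (par i) h)

  -- Each step to a parent lowers the index, so fuel that reaches the index of `x` suffices.
  ≼⇒ancF : ∀ f {a x} → toℕ x ≤ f → a ≼ x → ancF f a x ≡ true
  ≼⇒ancF f {a} {x} x≤f p with a Fin.≟ x
  ≼⇒ancF f x≤f p | yes _ = refl
  ≼⇒ancF f x≤f here | no a≢a = contradiction refl a≢a
  ≼⇒ancF (suc f) x≤f (up {i} p) | no _ = ≼⇒ancF f (≤-trans (par-lt i) (s≤s⁻¹ x≤f)) p

  inSubtree⇒≼ : ∀ a x → inSubtree a x ≡ true → a ≼ x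
  inSubtree⇒≼ = ancF⇒≼ (suc m)

  ≼⇒inSubtree : ∀ {a x} → a ≼ x → inSubtree a x ≡ true
  ≼⇒inSubtree {x = x} = ≼⇒ancF (suc m) (<⇒≤ (Fin.toℕ<n x))

module _ {n : ℕ} {M : Matroid n} (D : TreeDec M) where
  open TreeDec D
  open Tree T
  open Ancestors T

  ∈preSub⇒≼ : ∀ {e} a → e ∈ preSub M D a → a ≼ τ e
  ∈preSub⇒≼ {e} a e∈ = inSubtree⇒≼ a (τ e) inSub
    where
    inSub : inSubtree a (τ e) ≡ true
    inSub with inSubtree a (τ e) | trans (sym (lookup∘tabulate _ e)) ([]=⇒lookup e∈)
    ... | true  | _ = refl
    ... | false | ()

  ≼⇒∈preSub : ∀ {e} a → a ≼ τ e → e ∈ preSub M D a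
  ≼⇒∈preSub {e} a a≼ with Vec.lookup (preSub M D a) e in eq
  ... | true  = lookup⇒[]= e _ eq
  ... | false with inSubtree a (τ e) | ≼⇒inSubtree a≼ | trans (sym (lookup∘tabulate _ e)) eq
  ... | .true | refl | ()

-- The matroid as an instance, and its separations and stars in terms of weights.

module MatroidDuality {n : ℕ} (M : Matroid n) (k : ℕ) where
  open Matroid M

  ρ : ℕ
  ρ = rM M

  -- The rank of the contraction of `M` by `∁ A`, or equivalently the nullity of `A` in the dual
  -- matroid.
  d : Subset n → ℕ
  d A = ρ ∸ r (∁ A)

  d-spec : ∀ A → d A + r (∁ A) ≡ ρ
  d-spec A = m∸n+n≡m (r-mono ⊆⊤)

  d-⊥ : d ⊥ ≡ 0
  d-⊥ = m≤n⇒m∸n≡0 (r-mono λ _ → x∉p⇒x∈∁p ∉⊥)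

  d-mono : ∀ {A B} → A ⊆ B → d A ≤ d B
  d-mono A⊆B = ∸-monoʳ-≤ ρ (r-mono (p⊆q⇒∁p⊇∁q A⊆B))

  -- Complementation exchanges unions and intersections, and the minus sign turns submodularity of
  -- `r` into supermodularity of `d`.
  d-supermod : ∀ {A B P Q} → A ⊆ P → B ⊆ P → A ∩ B ⊆ Q → d A + d B ≤ d P + d Q
  d-supermod {A} {B} {P} {Q} A⊆P B⊆P A∩B⊆Q = +-cancelʳ-≤ (r (∁ A) + r (∁ B)) (d A + d B) (d P + d Q) (begin
    (d A + d B) + (r (∁ A) + r (∁ B))   ≡⟨ interchange (d A) (d B) (r (∁ A)) (r (∁ B)) ⟩
    (d A + r (∁ A)) + (d B + r (∁ B))   ≡⟨ cong₂ _+_ (trans (d-spec A) (sym (d-spec P))) (trans (d-spec B) (sym (d-spec Q))) ⟩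
    (d P + r (∁ P)) + (d Q + r (∁ Q))   ≡⟨ interchange (d P) (r (∁ P)) (d Q) (r (∁ Q)) ⟩
    (d P + d Q) + (r (∁ P) + r (∁ Q))   ≤⟨ +-monoʳ-≤ (d P + d Q) (+-mono-≤
                                             (r-mono {Y = ∁ A ∩ ∁ B} λ x∈ → x∈p∩q⁺ (p⊆q⇒∁p⊇∁q A⊆P x∈ , p⊆q⇒∁p⊇∁q B⊆P x∈))
                                             (r-mono {Y = ∁ A ∪ ∁ B} ∁Q⊆)) ⟩
    (d P + d Q) + (r (∁ A ∩ ∁ B) + r (∁ A ∪ ∁ B)) ≤⟨ +-monoʳ-≤ (d P + d Q)
                                             (≤-trans (≤-reflexive (+-comm (r (∁ A ∩ ∁ B)) _)) (r-submod (∁ A) (∁ B))) ⟩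
    (d P + d Q) + (r (∁ A) + r (∁ B))   ∎)
    where
    open ≤-Reasoning
    interchange : ∀ a b c e → (a + b) + (c + e) ≡ (a + c) + (b + e)
    interchange = solve-∀
    ∁Q⊆ : ∁ Q ⊆ ∁ A ∪ ∁ B
    ∁Q⊆ {x} x∈∁Q with x ∈? A
    ... | no x∉A = x∈p∪q⁺ (inj₁ (x∉p⇒x∈∁p x∉A))
    ... | yes x∈A = x∈p∪q⁺ (inj₂ (x∉p⇒x∈∁p λ x∈B → x∈∁p⇒x∉p x∈∁Q (A∩B⊆Q (x∈p∩q⁺ (x∈A , x∈B)))))

  open Duality d ρ k d-⊥ d-mono d-supermod

  r∁ : ∀ A → + r (∁ A) ≡ + ρ ℤ.- + d A
  r∁ A = trans (sym (cancel (+ d A) (+ r (∁ A)))) (cong (λ v → + v ℤ.- + d A) (d-spec A))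
    where
    cancel : ∀ x y → (x ℤ.+ y) ℤ.- x ≡ y
    cancel = ℤ-Solver.solve-∀

  conn≡ : ∀ A → conn M A ≡ + ρ ℤ.- + w A
  conn≡ A = begin
    (+ r A ℤ.+ + r (∁ A)) ℤ.- + ρ                      ≡⟨ cong (λ v → (v ℤ.+ + r (∁ A)) ℤ.- + ρ)
                                                            (trans (cong (+_ ∘ r) (sym (∁-involutive A))) (r∁ (∁ A))) ⟩
    ((+ ρ ℤ.- + d (∁ A)) ℤ.+ + r (∁ A)) ℤ.- + ρ        ≡⟨ cong (λ v → ((+ ρ ℤ.- + d (∁ A)) ℤ.+ v) ℤ.- + ρ) (r∁ A) ⟩
    ((+ ρ ℤ.- + d (∁ A)) ℤ.+ (+ ρ ℤ.- + d A)) ℤ.- + ρ  ≡⟨ simplify (+ ρ) (+ d A) (+ d (∁ A)) ⟩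
    + ρ ℤ.- (+ d A ℤ.+ + d (∁ A))                      ∎
    where
    open ≡-Reasoning
    simplify : ∀ x a b → ((x ℤ.- b) ℤ.+ (x ℤ.- a)) ℤ.- x ≡ x ℤ.- (a ℤ.+ b)
    simplify = ℤ-Solver.solve-∀

  low⇒InS : ∀ {A} → Low A → InS M k (sep A)
  low⇒InS {A} low = refl , subst (ℤ._< + k) (sym (conn≡ A)) (a<c+b⇒a-b<c ρ (w A) k low)

  InS⇒low : ∀ {s} → InS M k s → Low (proj₁ s)
  InS⇒low {A , _} (refl , ord<k) = a-b<c⇒a<c+b ρ (w A) k (subst (ℤ._< + k) (conn≡ A) ord<k)

  star≡ : ∀ {σ} → All IsBip σ → ⟨_⟩ M σ ≡ + ρ ℤ.- + weight (map proj₁ σ)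
  star≡ {σ} bips = cong (λ v → + ρ ℤ.+ v) (sum≡ bips)
    where
    open ≡-Reasoning
    step : ∀ x a b → ((x ℤ.- a) ℤ.- x) ℤ.- b ≡ ℤ.- (a ℤ.+ b)
    step = ℤ-Solver.solve-∀
    sum≡ : ∀ {σ} → All IsBip σ → sumℤ (map (λ s → + r (proj₂ s) ℤ.- + ρ) σ) ≡ ℤ.- + weight (map proj₁ σ)
    sum≡ [] = refl
    sum≡ {(A , _) ∷ σ} (refl ∷ bips) = begin
      (+ r (∁ A) ℤ.- + ρ) ℤ.+ sumℤ (map (λ s → + r (proj₂ s) ℤ.- + ρ) σ)  ≡⟨ cong₂ (λ u v → (u ℤ.- + ρ) ℤ.+ v) (r∁ A) (sum≡ bips) ⟩
      ((+ ρ ℤ.- + d A) ℤ.- + ρ) ℤ.- + weight (map proj₁ σ)                ≡⟨ step (+ ρ) (+ d A) (+ weight (map proj₁ σ)) ⟩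
      ℤ.- + (d A + weight (map proj₁ σ))                                  ∎

  InF⇒star : ∀ {σ} → Unique σ → InF M k σ → AllPairs Disjoint (map proj₁ σ) × ρ < k + weight (map proj₁ σ)
  InF⇒star {σ} unique (bips , (_ , star) , cost) =
    AllPairs.map⁺ {f = proj₁} (AllPairs-unique {R = λ s t → Disjoint (proj₁ s) (proj₁ t)} unique disj) ,
    a-b<c⇒a<c+b ρ (weight (map proj₁ σ)) k (subst (ℤ._< + k) (star≡ bips) cost)
    where
    disj : ∀ s t → s ∈ˡ σ → t ∈ˡ σ → s ≢ t → Disjoint (proj₁ s) (proj₁ t)
    disj s t s∈ t∈ s≢t = subst (proj₁ s ⊆_) (All.lookup bips t∈) (proj₁ (star s t s∈ t∈ s≢t))

  star⇒InF : ∀ {σ} → AllPairs Disjoint σ → All (λ A → A ≢ ∁ A) σ → ρ < k + weight σ → InF M k (map sep σ)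
  star⇒InF {σ} disj nondeg cost = bips , (nondeg′ , star) ,
    subst (ℤ._< + k) (sym (star≡ bips)) (a<c+b⇒a-b<c ρ _ k (subst (λ τ → ρ < k + weight τ) proj≡ cost))
    where
    proj≡ : σ ≡ map proj₁ (map sep σ)
    proj≡ = trans (sym (map-id σ)) (map-∘ σ)
    bips : All IsBip (map sep σ)
    bips = All.map⁺ (All.universal (λ _ → refl) σ)
    nondeg′ : ∀ s → s ∈ˡ map sep σ → s ≢ inv s
    nondeg′ s s∈ with ∈-map⁻ sep s∈
    ... | A , A∈ , refl = All.lookup nondeg A∈ ∘ cong proj₁
    star : ∀ s t → s ∈ˡ map sep σ → t ∈ˡ map sep σ → s ≢ t → s ≤S inv t
    star s t s∈ t∈ s≢t with ∈-map⁻ sep s∈ | ∈-map⁻ sep t∈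
    ... | A , A∈ , refl | B , B∈ , refl = A⊥B , disjoint-sym {A = A} A⊥B
      where
      A⊥B : Disjoint A B
      A⊥B = AllPairs-lookup (λ {A} {B} → disjoint-sym {A = A} {B}) disj A∈ B∈ (s≢t ∘ cong sep)

  sep-unique : ∀ {σ : List (Subset n)} → Unique σ → Unique (map sep σ)
  sep-unique = Unique.map⁺ (cong proj₁)

  -- Tangles and families of small sets.

  smallTangle⇒tangle : ∀ {G} → IsSmallTangle G → HasTangle M k
  smallTangle⇒tangle {G} tangle = O , O⊆S , orients , (λ s inS _ → antisymmetric s) , consistent , avoids
    where
    open IsSmallTangle tangle
    small? : ∀ (s : Sep n) → Dec (IsBip s × proj₁ s ∈ˡ G)
    small? (A , B) = B ≟ˢ ∁ A ×-dec A ∈?ˡ G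
    O : Sep n → Bool
    O s = does (small? s)
    O⁻ : ∀ s → O s ≡ true → IsBip s × proj₁ s ∈ˡ G
    O⁻ s = does-true (small? s)
    O⊆S : ∀ s → O s ≡ true → InS M k s
    O⊆S s h with O⁻ s h
    ... | refl , A∈G = low⇒InS (IsSmall.low isSmall A∈G)
    orients : ∀ s → InS M k s → O s ≡ true ⊎ O (inv s) ≡ true
    orients (A , _) inS@(refl , _) with total A (InS⇒low inS)
    ... | inj₁ A∈G  = inj₁ (dec-true (small? (A , ∁ A)) (refl , A∈G))
    ... | inj₂ ∁A∈G = inj₂ (dec-true (small? (∁ A , A)) (sym (∁-involutive A) , ∁A∈G))
    not-both : ∀ {A} → Low A → A ∈ˡ G → ¬ (∁ A ∈ˡ G)
    -- `A` and `∁ A` form a star of weight `w A`, so low order alone makes it a forbidden one.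
    not-both {A} low A∈G ∁A∈G = starFree (A ∷ ∁ A ∷ []) (
      ((disjoint-∁ A ∷ []) ∷ [] ∷ []) ,
      (A∈G ∷ ∁A∈G ∷ []) ,
      subst (λ v → ρ < k + (d A + v)) (sym (+-identityʳ _)) low)
    antisymmetric : ∀ s → O s ≡ true → O (inv s) ≡ true → Absurd
    antisymmetric s h h′ with O⁻ s h | O⁻ (inv s) h′
    ... | refl , A∈G | _ , ∁A∈G = not-both (IsSmall.low isSmall A∈G) A∈G ∁A∈G
    consistent : ∀ s t → InS M k s → InS M k t → s ≢ t → s ≢ inv t → s <S t →
      O (inv s) ≡ true → O t ≡ true → Absurd
    consistent (A , _) t inS@(refl , _) inS′ _ _ ((A⊆C , _) , _) h h′ with O⁻ (∁ A , A) h | O⁻ t h′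
    ... | _ , ∁A∈G | refl , C∈G =
      not-both (InS⇒low inS) (IsSmall.closed isSmall C∈G A⊆C (InS⇒low inS)) ∁A∈G
    avoids : ∀ σ → Unique σ → All (λ s → O s ≡ true) σ → ¬ InF M k σ
    avoids σ unique all inF = let disj , cost = InF⇒star unique inF in
      starFree (map proj₁ σ) (disj , All.map⁺ (All.map (λ {s} h → proj₂ (O⁻ s h)) all) , cost)

  -- Dropping the empty members keeps the weight. The nonempty ones are distinct and differ from
  -- their own complements, so they give a star in F_k inside `O`.
  tangle⇒starFree : ∀ {O} → IsTangle M k O → ∀ {σ} → AllPairs Disjoint σ →
    All (λ A → Nonempty A → O (sep A) ≡ true) σ → ¬ (ρ < k + weight σ)
  tangle⇒starFree (_ , _ , _ , _ , avoids) {σ} disj all cost = avoids (map sep (nonempties σ))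
    (sep-unique (disjoint-unique disj′ ne))
    (All.map⁺ (All.zipWith (λ (h , A≢∅) → h A≢∅) (All.filter⁺ nonempty? all , ne)))
    (star⇒InF disj′ (All.map nonempty≢∁ ne) (subst (λ v → ρ < k + v) (sym (weight-nonempties σ)) cost))
    where
    disj′ = AllPairs.filter⁺ nonempty? disj
    ne    = All.all-filter nonempty? σ

  -- Sinks of an oriented tree, and S_k-trees from layouts.

  module _ (T : Tree) where
    open Tree T

    -- The last i satisfying P works, because children have larger indices than their parents.
    sink : ∀ {P : Fin m → Set} → (∀ i → Dec (P i)) →
      ∃ λ t → (∀ i → par i ≡ t → ¬ P i) × (∀ j → t ≡ suc j → P j)
    sink P? with last P?
    ... | inj₁ none = zero , (λ i _ → none i) , λ j ()
    ... | inj₂ (j , p , max) = suc j , (λ i eq → max i (subst (λ x → toℕ x ≤ toℕ i) eq (par-lt i))) , λ { _ refl → p }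

  ∈-downEdges⁻ : ∀ T {i t} → i ∈ˡ Tree.downEdges T t → Tree.par T i ≡ t
  ∈-downEdges⁻ T {t = t} i∈ = proj₂ (∈-filter⁻ (λ i → Tree.par T i Fin.≟ t) {xs = allFin (Tree.m T)} i∈)

  ∈-downEdges⁺ : ∀ T i → i ∈ˡ Tree.downEdges T (Tree.par T i)
  ∈-downEdges⁺ T i = ∈-filter⁺ (λ j → Tree.par T j Fin.≟ Tree.par T i) (∈-allFin i) refl

  ¬true⇒false : ∀ {b} → ¬ (b ≡ false) → b ≡ true
  ¬true⇒false {true}  _ = refl
  ¬true⇒false {false} h = contradiction refl h

  false≢true : ∀ {b} → b ≡ false → ¬ (b ≡ true)
  false≢true refl ()

  tangle⇒¬SkTree : HasTangle M k → ¬ HasSkTree M k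
  tangle⇒¬SkTree (O , isTangle@(_ , orients , _ , _ , avoids)) (T , α , inS , stars) =
    -- An edge with `O (α i) ≡ false` points down to its child. At a sink all edges point inwards,
    -- so its whole star lies in `O`.
    contradict (sink T (λ i → O (α i) Bool.≟ false))
    where
    open Tree T
    downO : ∀ {t} → (∀ i → par i ≡ t → ¬ O (α i) ≡ false) → All (λ s → O s ≡ true) (map α (downEdges t))
    downO h = All.map⁺ (All.tabulate λ i∈ → ¬true⇒false (h _ (∈-downEdges⁻ T i∈)))
    upO : ∀ j → O (α j) ≡ false → O (inv (α j)) ≡ true
    upO j h = [ (λ h′ → contradiction h′ (false≢true h)) , id ]′ (orients (α j) (proj₁ (inS j)))
    avoid : ∀ {l} → All (λ s → O s ≡ true) l → ¬ SetInF M k l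
    avoid all (σ , unique , σ⇔l , inF) =
      avoids σ unique (All.tabulate λ s∈ → All.lookup all (Equivalence.to (σ⇔l _) s∈)) inF
    contradict : ¬ ∃ λ t → (∀ i → par i ≡ t → ¬ O (α i) ≡ false) × (∀ j → t ≡ suc j → O (α j) ≡ false)
    contradict (zero  , down , _)  = avoid (All.++⁺ (downO down) []) (stars zero)
    contradict (suc j , down , up) = avoid (All.++⁺ (downO down) (upO j (up j refl) ∷ [])) (stars (suc j))

  module _ (𝓛 : TreeLayout) where
    open TreeLayout 𝓛

    low-set : ∀ i → Low (set (suc i))
    low-set i = <-≤-trans (cost (isNode (par i))) (+-monoʳ-≤ k
      (weight≤w (star-disjoint (isNode (par i))) (there (∈-map⁺ (set ∘ child) (∈-downEdges⁺ T i)))))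

    -- The sink argument again, now allowing empty parts, as these occur in layouts of arbitrary
    -- tree-decompositions.
    tangle⇒¬layout : ¬ HasTangle M k
    tangle⇒¬layout (O , isTangle@(_ , orients , _))
      with sink T (λ i → O (sep (set (suc i))) Bool.≟ false)
    ... | t , down , up = tangle⇒starFree isTangle (star-disjoint (isNode t))
      (outer t up ∷ All.map⁺ (All.tabulate λ i∈ _ → ¬true⇒false (down _ (∈-downEdges⁻ T i∈))))
      (cost (isNode t))
      where
      outer : ∀ t → (∀ j → t ≡ suc j → O (sep (set (suc j))) ≡ false) →
        Nonempty (∁ (set t)) → O (sep (∁ (set t))) ≡ true
      outer zero _ (x , x∈) = contradiction (subst (x ∈_) (sym root) ∈⊤) (x∈∁p⇒x∉p x∈)
      outer (suc j) up _ = [ (λ h → contradiction h (false≢true (up j refl))) , subst (λ s → O s ≡ true) (inv-sep _) ]′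
        (orients (sep (set (suc j))) (low⇒InS (low-set j)))

    layout⇒SkTree : (∀ t → All Nonempty (branches t)) → HasSkTree M k
    layout⇒SkTree ne = T , sep ∘ set ∘ suc ,
      (λ i → low⇒InS (low-set i) , subst (InS M k) (sym (inv-sep _)) (low⇒InS (low-∁ _ (low-set i)))) ,
      λ { zero → starRoot ; (suc j) → starChild j }
      where
      ne-set : ∀ i → Nonempty (set (suc i))
      ne-set i = All.lookup (ne (par i)) (∈-map⁺ (set ∘ child) (∈-downEdges⁺ T i))
      seps≡ : ∀ t → map sep (branches t) ≡ map (sep ∘ set ∘ suc) (downEdges t)
      seps≡ t = sym (map-∘ (downEdges t))
      setInF : ∀ {σ l} → AllPairs Disjoint σ → Unique σ → All (λ A → A ≢ ∁ A) σ → ρ < k + weight σ →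
        map sep σ ↭ l → SetInF M k l
      setInF disj unique nondeg cost p = _ , sep-unique unique ,
        (λ s → mk⇔ (↭.∈-resp-↭ p) (↭.∈-resp-↭ (↭-sym p))) , star⇒InF disj nondeg cost
      d-∁root : d (∁ (set zero)) ≡ 0
      d-∁root = trans (cong d (trans (cong ∁ root) ∁⊤≡⊥)) d-⊥
      starRoot : SetInF M k (map (sep ∘ set ∘ suc) (downEdges zero) ++ [])
      starRoot = setInF (disjoint (isNode zero)) (disjoint-unique (disjoint (isNode zero)) (ne zero))
        (All.map nonempty≢∁ (ne zero))
        (subst (λ v → ρ < k + (v + weight (branches zero))) d-∁root (cost (isNode zero)))
        (subst (λ l → map sep (branches zero) ↭ l ++ []) (seps≡ zero) (↭-sym (↭.++-identityʳ _)))
      starChild : ∀ j → SetInF M k (map (sep ∘ set ∘ suc) (downEdges (suc j)) ++ inv (sep (set (suc j))) ∷ [])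
      starChild j = setInF (star-disjoint (isNode t))
        -- The outer part may be empty, but it differs from every child, which is a nonempty subset
        -- of `set t`.
        (All.map (λ { {B} (B⊆A , B≢∅) refl → nonempty∩∁ B⊆A B≢∅ }) (All.zip (inner (isNode t) , ne t))
          ∷ disjoint-unique (disjoint (isNode t)) (ne t))
        ((λ eq → nonempty≢∁ (ne-set j) (trans (sym (∁-involutive (set t))) (sym eq))) ∷ All.map nonempty≢∁ (ne t))
        (cost (isNode t))
        (subst₂ (λ l s → sep (∁ (set t)) ∷ map sep (branches t) ↭ l ++ s ∷ []) (seps≡ t) (sym (inv-sep (set t)))
          (↭.++-comm (sep (∁ (set t)) ∷ []) (map sep (branches t))))
        where
        t = suc j
        nonempty∩∁ : ∀ {A} → ∁ A ⊆ A → ¬ Nonempty (∁ A)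
        nonempty∩∁ ∁A⊆A (x , x∈) = x∈∁p⇒x∉p x∈ (∁A⊆A x∈)

  -- Layouts from tree-decompositions of small width.

  sum-r∁ : ∀ {m} (f : Fin m → Subset n) xs →
    sumℤ (map (λ i → + r (∁ (f i))) xs) ≡ + length xs ℤ.* + ρ ℤ.- + weight (map f xs)
  sum-r∁ f [] = refl
  sum-r∁ f (x ∷ xs) = trans (cong₂ ℤ._+_ (r∁ (f x)) (sum-r∁ f xs))
    (step (+ ρ) (+ d (f x)) (+ length xs) (+ weight (map f xs)))
    where
    step : ∀ x a l v → (x ℤ.- a) ℤ.+ (l ℤ.* x ℤ.- v) ≡ (+ 1 ℤ.+ l) ℤ.* x ℤ.- (a ℤ.+ v)
    step = ℤ-Solver.solve-∀

  module _ (D : TreeDec M) where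
    open TreeDec D
    open Tree T
    open Ancestors T

    preSub-zero : preSub M D zero ≡ ⊤
    preSub-zero = ⊆-antisym ⊆⊤ (λ {e} _ → ≼⇒∈preSub D zero (zero≼ _ (τ e) ≤-refl))

    starWeight : Node → ℕ
    starWeight t = d (∁ (preSub M D t)) + weight (map (preSub M D ∘ child) (downEdges t))

    -- The multiples of `ρ` cancel against the degree term, so the width of `t` is `⟨_⟩` of the star
    -- at `t`. The root has one component fewer, matching an outer part of weight zero.
    nodeWidth≡ : ∀ t → nodeWidth M D t ≡ + ρ ℤ.- + starWeight t
    nodeWidth≡ zero = begin
      (sumℤ (map (λ i → + r (∁ (preSub M D (child i)))) es) ℤ.+ + 0) ℤ.- (+ (length es + 0) ℤ.- + 1) ℤ.* + ρ
        ≡⟨ cong (λ v → (v ℤ.+ + 0) ℤ.- (+ (length es + 0) ℤ.- + 1) ℤ.* + ρ) (sum-r∁ (preSub M D ∘ child) es) ⟩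
      ((+ length es ℤ.* + ρ ℤ.- + v) ℤ.+ + 0) ℤ.- ((+ length es ℤ.+ + 0) ℤ.- + 1) ℤ.* + ρ
        ≡⟨ simplify (+ ρ) (+ length es) (+ v) ⟩
      + ρ ℤ.- + v
        ≡⟨ cong (λ u → + ρ ℤ.- + (u + v)) (sym d≡0) ⟩
      + ρ ℤ.- + starWeight zero ∎
      where
      open ≡-Reasoning
      es = downEdges zero
      v  = weight (map (preSub M D ∘ child) es)
      d≡0 : d (∁ (preSub M D zero)) ≡ 0
      d≡0 = trans (cong d (trans (cong ∁ preSub-zero) ∁⊤≡⊥)) d-⊥
      simplify : ∀ x l v → ((l ℤ.* x ℤ.- v) ℤ.+ + 0) ℤ.- ((l ℤ.+ + 0) ℤ.- + 1) ℤ.* x ≡ x ℤ.- v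
      simplify = ℤ-Solver.solve-∀
    nodeWidth≡ t@(suc j) = begin
      (sumℤ (map (λ i → + r (∁ (preSub M D (child i)))) es) ℤ.+ + r (preSub M D t)) ℤ.- (+ (length es + 1) ℤ.- + 1) ℤ.* + ρ
        ≡⟨ cong₂ (λ u v → (u ℤ.+ v) ℤ.- (+ (length es + 1) ℤ.- + 1) ℤ.* + ρ) (sum-r∁ (preSub M D ∘ child) es)
             (trans (cong (+_ ∘ r) (sym (∁-involutive (preSub M D t)))) (r∁ (∁ (preSub M D t)))) ⟩
      ((+ length es ℤ.* + ρ ℤ.- + v) ℤ.+ (+ ρ ℤ.- + d (∁ (preSub M D t)))) ℤ.- ((+ length es ℤ.+ + 1) ℤ.- + 1) ℤ.* + ρ
        ≡⟨ simplify (+ ρ) (+ length es) (+ v) (+ d (∁ (preSub M D t))) ⟩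
      + ρ ℤ.- + starWeight t ∎
      where
      open ≡-Reasoning
      es = downEdges t
      v  = weight (map (preSub M D ∘ child) es)
      simplify : ∀ x l v a → ((l ℤ.* x ℤ.- v) ℤ.+ (x ℤ.- a)) ℤ.- ((l ℤ.+ + 1) ℤ.- + 1) ℤ.* x ≡ x ℤ.- (a ℤ.+ v)
      simplify = ℤ-Solver.solve-∀

    siblings-disjoint : ∀ {i j} → par i ≡ par j → i ≢ j → Disjoint (preSub M D (suc i)) (preSub M D (suc j))
    siblings-disjoint {i} {j} eq i≢j e∈i = x∉p⇒x∈∁p λ e∈j →
      [ siblings-⋠ eq i≢j , siblings-⋠ (sym eq) (i≢j ∘ sym) ]′
        (≼-comparable (∈preSub⇒≼ D (suc i) e∈i) (∈preSub⇒≼ D (suc j) e∈j))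

    preSub-child : ∀ i → preSub M D (suc i) ⊆ preSub M D (par i)
    preSub-child i e∈ = ≼⇒∈preSub D (par i) (≼-trans (up here) (∈preSub⇒≼ D (suc i) e∈))

    width<⇒layout : width M D ℤ.< + k → TreeLayout
    width<⇒layout width<k = record
      { T = T ; set = preSub M D ; root = preSub-zero ; isNode = λ t → mkNode
        (AllPairs.map⁺ (AllPairs-unique {R = λ i j → Disjoint (preSub M D (suc i)) (preSub M D (suc j))}
          (Unique.filter⁺ (λ i → par i Fin.≟ t) (Unique.allFin⁺ m))
          λ i j i∈ j∈ → siblings-disjoint (trans (∈-downEdges⁻ T i∈) (sym (∈-downEdges⁻ T j∈)))))
        (All.map⁺ (All.tabulate λ {i} i∈ →
          subst (λ t → preSub M D (suc i) ⊆ preSub M D t) (∈-downEdges⁻ T i∈) (preSub-child i)))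
        (a-b<c⇒a<c+b ρ (starWeight t) k (subst (ℤ._< + k) (nodeWidth≡ t)
          (ℤ.≤-<-trans (≤-foldr-⊔ (nodeWidth M D) {nodeWidth M D zero} (∈-allFin t)) width<k))) }

  -- Tree-decompositions of small width from layouts.

  module _ (𝓛 : TreeLayout) where
    open TreeLayout 𝓛
    open Ancestors T

    set-child : ∀ i → set (suc i) ⊆ set (par i)
    set-child i = All.lookup (inner (isNode (par i))) (∈-map⁺ (set ∘ child) (∈-downEdges⁺ T i))

    set-anti : ∀ {a x} → a ≼ x → set x ⊆ set a
    set-anti here e∈ = e∈
    set-anti (up {i} p) e∈ = set-anti p (set-child i e∈)

    set-siblings : ∀ {i j} → par i ≡ par j → i ≢ j → Disjoint (set (suc i)) (set (suc j))
    set-siblings {i} {j} eq = AllPairs-lookup (λ {i} {j} → disjoint-sym {A = set (suc i)} {set (suc j)})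
      (AllPairs.map⁻ (disjoint (isNode (par i))))
      (∈-downEdges⁺ T i) (subst (λ t → j ∈ˡ downEdges t) (sym eq) (∈-downEdges⁺ T j))

    -- The nodes whose sets contain `e` form a chain, since siblings have disjoint sets. The bound
    -- `b` on the index of `y` drives the induction.
    ∈-set-chain : ∀ b {e x y} → toℕ y ≤ b → toℕ x ≤ toℕ y → e ∈ set x → e ∈ set y → x ≼ y
    ∈-set-chain _ {x = zero} {y} _ _ _ _ = zero≼ _ y ≤-refl
    ∈-set-chain (suc b) {e} {x} {suc j} j<b x≤y e∈x e∈y with x Fin.≟ suc j | toℕ x ≤? toℕ (par j)
    ... | yes refl | _ = here
    ... | no _ | yes x≤p = up (∈-set-chain b (≤-trans (par-lt j) (s≤s⁻¹ j<b)) x≤p e∈x (set-child j e∈y))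
    -- The index of `x` lies strictly between those of `par j` and `suc j`. By induction `par j` is
    -- an ancestor of `x`, and the child leading to `x` is not `suc j`, so disjointness of sibling
    -- sets is violated.
    ... | no x≢y | no x≰p = contradiction e∈y
      (x∈∁p⇒x∉p (set-siblings par≡ i≢j (set-anti child≼x e∈x)))
      where
      x<y : toℕ x < suc (toℕ j)
      x<y = ≤∧≢⇒< x≤y (x≢y ∘ Fin.toℕ-injective)
      p≼x : par j ≼ x
      p≼x = ∈-set-chain b (≤-trans (s≤s⁻¹ x<y) (s≤s⁻¹ j<b)) (<⇒≤ (≰⇒> x≰p)) (set-child j e∈y) e∈x
      branch : ∃ λ i → par i ≡ par j × suc i ≼ x
      branch = ≼-child p≼x (λ eq → x≰p (≤-reflexive (cong toℕ (sym eq))))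
      i = proj₁ branch
      par≡ = proj₁ (proj₂ branch)
      child≼x = proj₂ (proj₂ branch)
      i≢j : i ≢ j
      i≢j eq = <⇒≱ x<y (subst (λ i → suc (toℕ i) ≤ toℕ x) eq (≼⇒≤ child≼x))

    -- On the chain of nodes whose sets contain `e`, the largest index marks the lowest node.
    -- Placing `e` there makes the preimage of each subtree equal to the set of its top node.
    deepest : ∀ e → ∃ λ t → e ∈ set t × (∀ x → e ∈ set x → toℕ x ≤ toℕ t)
    deepest e with last (λ i → e ∈? set (suc i))
    ... | inj₁ none = zero , subst (e ∈_) (sym root) ∈⊤ , λ { zero _ → z≤n ; (suc i) e∈ → contradiction e∈ (none i) }
    ... | inj₂ (j , e∈j , max) = suc j , e∈j ,
      λ { zero _ → z≤n ; (suc i) e∈ → ≮⇒≥ λ j<i → max i (s≤s⁻¹ j<i) e∈ }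

    treeDec : TreeDec M
    treeDec = record { T = T ; τ = proj₁ ∘ deepest }

    preSub≡set : ∀ t → preSub M treeDec t ≡ set t
    preSub≡set t = ⊆-antisym
      (λ {e} e∈ → set-anti (∈preSub⇒≼ treeDec t e∈) (proj₁ (proj₂ (deepest e))))
      (λ {e} e∈ → let y , e∈y , max = deepest e in
        ≼⇒∈preSub treeDec t (∈-set-chain (toℕ y) ≤-refl (max t e∈) e∈ e∈y))

    treeDec-width : width M treeDec ℤ.< + k
    treeDec-width = foldr-⊔-< (nodeWidth M treeDec) (allFin (suc m)) (narrow zero) narrow
      where
      narrow : ∀ t → nodeWidth M treeDec t ℤ.< + k
      narrow t = subst (ℤ._< + k) (sym (nodeWidth≡ treeDec t)) (a<c+b⇒a-b<c ρ (starWeight treeDec t) k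
        (subst (λ v → ρ < k + v) (sym (cong₂ (λ A σ → d (∁ A) + weight σ) (preSub≡set t)
          (map-cong (preSub≡set ∘ child) (downEdges t)))) (cost (isNode t))))

  -- The dichotomy between tangles and trees.

  data Alternative : Set where
    tangled   : HasTangle M k → Alternative
    decomposed : HasSkTree M k → (∃ λ D → width M D ℤ.< + k) → Alternative

  alternative : 0 < k → Alternative
  alternative 0<k = [ decompose , (λ (_ , tangle) → tangled (smallTangle⇒tangle tangle)) ]′ (duality low-⊥)
    where
    r⊥≡0 : r (∁ (∁ ⊥)) ≡ 0
    r⊥≡0 = n≤0⇒n≡0 (subst₂ (λ A v → r A ≤ v) (sym (∁-involutive ⊥)) (∣⊥∣≡0 n) (r-bound ⊥))
    -- As `r ⊥` is zero, `d (∁ ⊥)` equals `ρ`, so `0 < k` gives the empty set order below `k`.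
    low-⊥ : Low ⊥
    low-⊥ = <-≤-trans (m<n+m ρ 0<k)
      (+-monoʳ-≤ k (≤-trans (≤-reflexive (cong (ρ ∸_) (sym r⊥≡0))) (m≤n+m (d (∁ ⊥)) (d ⊥))))
    decompose : Branch (⊥ ∷ []) ⊤ → Alternative
    decompose t = let 𝓛 , ne = layout (prune low-⊥ t) in
      decomposed (layout⇒SkTree 𝓛 ne) (treeDec 𝓛 , treeDec-width 𝓛)

theorem8p5 : ∀ {n : ℕ} (M : Matroid n) (k : ℕ) → 0 < k →
    (TreeWidthAtLeast M k ⇔ (¬ HasSkTree M k)) × ((¬ HasSkTree M k) ⇔ HasTangle M k)
theorem8p5 M k 0<k = conclude (alternative 0<k)
  where
  open MatroidDuality M k
  conclude : Alternative → (TreeWidthAtLeast M k ⇔ (¬ HasSkTree M k)) × ((¬ HasSkTree M k) ⇔ HasTangle M k)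
  -- With a tangle all three statements hold. In the other case the tree and the decomposition of
  -- small width make all three fail.
  conclude (tangled tangle) =
    mk⇔ (λ _ → noTree)
      (λ _ D → ℤ.≮⇒≥ λ width<k → tangle⇒¬layout (width<⇒layout D width<k) tangle) ,
    mk⇔ (λ _ → tangle) (λ _ → noTree)
    where noTree = tangle⇒¬SkTree tangle
  conclude (decomposed tree (D , width<k)) =
    mk⇔ (λ wide → contradiction width<k (ℤ.≤⇒≯ (wide D))) (contradiction tree) ,
    mk⇔ (contradiction tree) tangle⇒¬SkTree
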